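{- (Subject reduction for expressions.) Let $\Gamma$ be a typing environment, $e,e'$ expressions and $t$ a type. If $\Gamma\vdash e:t$ and $e\longrightarrow e'$, then $\Gamma\vdash e':t$.
   Context: **Syntax.** Fix an infinite set of channels $a,b,c,\dots$ and a disjoint infinite set of variables $x,y,z,\dots$. A channel is used either as a shared channel or as a session channel; a session channel $a$ has two endpoints $a^+,a^-$. Polarities are $p,q\in\{+,-\}$, with $\overline{+}=-$, $\overline{ - }=+$. A bindable name $X$ is a channel or a variable; a name $u$ is a bindable name or an endpoint. Expressions are $e,f::=k\mid u\mid\lambda x.e\mid e\,f\mid\mathsf{split}\ e\ \mathsf{as}\ x,y\ \mathsf{in}\ f$, where $\lambda x$ binds $x$ in $e$, the split binds $x,y$ in $f$, and constants are $k::=\mathsf{unit}\mid\mathsf{pair}\mid\mathsf{open}\mid\mathsf{send}\mid\mathsf{recv}\mid\mathsf{future}\mid\mathsf{return}\mid\mathsf{bind}$. Abbreviations: $\langle e,f\rangle=\mathsf{pair}\,e\,f$ and $(e\gg= f)=\mathsf{bind}\,e\,f$. Expressions are identified up to renaming of bound names. **Reduction of expressions.** Evaluation contexts: $\mathcal E::=[\,]\mid\mathcal E\,e\mid\mathsf{split}\ \mathcal E\ \mathsf{as}\ x,y\ \mathsf{in}\ e\mid\mathsf{open}\,\mathcal E\mid\mathsf{send}\,\mathcal E\mid\mathsf{recv}\,\mathcal E\mid\mathsf{bind}\,\mathcal E$. The relation $\longrightarrow$ is generated by: $(\lambda x.e)f\longrightarrow e\{f/x\}$; $(\mathsf{return}\,e\gg=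 f)\longrightarrow f\,e$; $\mathsf{split}\ \langle e_1,e_2\rangle\ \mathsf{as}\ x,y\ \mathsf{in}\ f\longrightarrow f\{e_1,e_2/x,y\}$; and $\mathcal E[e]\longrightarrow\mathcal E[f]$ whenever $e\longrightarrow f$. **Types.** Pre-types $t,s$ and pre-session types $T,S$ are the possibly infinite trees generated coinductively by $t::=\mathsf B\mid T\mid\langle T\rangle\mid t\times t\mid t\to t\mid t\multimap t\mid\mathsf{IO}\,t\mid\bullet t$ and $T::=\mathsf{end}\mid{?}t.T\mid{!}t.T\mid\bullet T$, with $\mathsf B$ ranging over basic types (such as $\mathsf{Unit}$). $\mathsf{lin}$ is the smallest predicate such that $\mathsf{lin}(?t.T)$, $\mathsf{lin}(!t.T)$, $\mathsf{lin}(t\multimap s)$, $\mathsf{lin}(\mathsf{IO}\,t)$ hold; $\mathsf{lin}(t)$ or $\mathsf{lin}(s)$ implies $\mathsf{lin}(t\times s)$; $\mathsf{lin}(t)$ implies $\mathsf{lin}(\bullet t)$. Put $\mathsf{un}(t)$ iff not $\mathsf{lin}(t)$. A pre-(session) type is a (session) type if: (1) each sub-term $t_1\to t_2$ with $\mathsf{un}(t_2)$ has $\mathsf{un}(t_1)$; (2) each sub-term $t_1\multimap t_2$ has $\mathsf{lin}(t_2)$; (3) its tree is regular (finitely many distinct sub-trees); (4) every infinite path of its tree contains infinitely many $\bullet$. All types below are types in this sense. $\bullet^n t$ is $t$ prefixed by $n$ bullets ($n\ge 0$). **Types of constants.** $\mathsf{types}(k)$ is the set of all instances ($t,s$ types,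 $T$ session type, $n\ge0$) of: $\mathsf{unit}:\mathsf{Unit}$; $\mathsf{return}:t\to\mathsf{IO}\,t$; $\mathsf{open}:\langle T\rangle\to\mathsf{IO}\,T$; $\mathsf{send}:{!}t.T\to t\multimap\mathsf{IO}\,T$; $\mathsf{recv}:{?}t.T\to\mathsf{IO}(t\times T)$; $\mathsf{future}:\bullet^n(\mathsf{IO}\,t)\to\mathsf{IO}\,\bullet^n t$; $\mathsf{pair}:t\to s\multimap t\times s$ if $\mathsf{lin}(t)$, $\mathsf{pair}:t\to s\to t\times s$ if $\mathsf{un}(t)$; $\mathsf{bind}:\mathsf{IO}\,t\to(t\multimap\mathsf{IO}\,s)\multimap\mathsf{IO}\,s$. Arrows associate to the right; precedence is $\bullet$, $\mathsf{IO}$, $\times$, then the arrows. **Typing of expressions.** A typing environment $\Gamma$ is a finite map sending variables to types, shared channels to types $\langle T\rangle$, endpoints to session types; "$\Gamma,u:t$" requires $u\notin\mathrm{dom}(\Gamma)$. $\mathsf{lin}(\Gamma)$ holds if some $u:t\in\Gamma$ has $\mathsf{lin}(t)$, otherwise $\mathsf{un}(\Gamma)$. The partial operation $\Gamma+\Gamma'$: $\Gamma+\emptyset=\Gamma$, $\Gamma+(\Gamma',u:t)=(\Gamma+\Gamma')+u:t$, where $\Gamma+u:t$ is $\Gamma,u:t$ if $u\notin\mathrm{dom}(\Gamma)$, is $\Gamma$ if $u:t\in\Gamma$ and $\mathsf{un}(t)$, and is undefined otherwise. Judgements $\Gamma\vdash e:t$ are derived by (any $n\ge0$): [$\bullet$I]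 $\Gamma\vdash e:t$ implies $\Gamma\vdash e:\bullet t$; [const] $\Gamma\vdash k:t$ if $\mathsf{un}(\Gamma)$, $t\in\mathsf{types}(k)$; [axiom] $\Gamma,u:t\vdash u:t$ if $\mathsf{un}(\Gamma)$; [$\to$I] $\Gamma,x:\bullet^n t\vdash e:\bullet^n s$ and $\mathsf{un}(\Gamma)$ imply $\Gamma\vdash\lambda x.e:\bullet^n(t\to s)$; [$\multimap$I] $\Gamma,x:\bullet^n t\vdash e:\bullet^n s$ implies $\Gamma\vdash\lambda x.e:\bullet^n(t\multimap s)$; [$\to$E],[$\multimap$E] $\Gamma_1\vdash e_1:\bullet^n(t\to s)$ (resp. $\bullet^n(t\multimap s)$) and $\Gamma_2\vdash e_2:\bullet^n t$ imply $\Gamma_1+\Gamma_2\vdash e_1e_2:\bullet^n s$; [$\times$E] $\Gamma_1\vdash e:\bullet^n(t_1\times t_2)$ and $\Gamma_2,x:\bullet^n t_1,y:\bullet^n t_2\vdash f:\bullet^n s$ imply $\Gamma_1+\Gamma_2\vdash\mathsf{split}\ e\ \mathsf{as}\ x,y\ \mathsf{in}\ f:\bullet^n s$. -}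

module Defs where

open import Data.Fin.Base using (Fin; zero; suc)
open import Data.List.Base using (List; []; _∷_; _∷ʳ_; _++_; applyUpTo; map)
open import Data.List.Membership.Propositional using (_∈_)
open import Data.List.Membership.Propositional.Properties using (∈-map⁺)
open import Data.List.Relation.Unary.Any using (Any; here; there)
open import Data.Maybe using (Maybe; just; nothing; Is-just)
open import Data.Maybe.Relation.Binary.Pointwise using (Pointwise)
import Data.Maybe.Relation.Unary.Any as Maybe
open import Data.Nat.Base using (ℕ; zero; suc; _≤_; _<_; z≤n; s≤s)
open import Data.Product.Base using (∃; ∃-syntax; _×_; _,_; proj₁; proj₂)
open import Data.Unit.Base using (⊤; tt)
open import Data.Vec.Base using (Vec; []; _∷_)
open import Function.Bundles using (_⇔_; mk⇔; Equivalence)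
open import Relation.Binary.PropositionalEquality using (_≡_; _≢_; refl)
open import Relation.Nullary.Negation.Core using (¬_)

-- Possibly infinite trees ----------------------------------------------------

data Basic : Set where
  Unit  : Basic
  other : ℕ → Basic

data Label : Set where
  basicˡ : Basic → Label
  endˡ inˡ outˡ chanˡ prodˡ funˡ lolliˡ ioˡ bulletˡ : Label

arity : Label → ℕ
arity (basicˡ _) = 0
arity endˡ       = 0
arity inˡ        = 2
arity outˡ       = 2
arity chanˡ      = 1
arity prodˡ      = 2
arity funˡ       = 2
arity lolliˡ     = 2
arity ioˡ        = 1
arity bulletˡ    = 1

-- A position lists the child indices met on the way down from the root.
Position : Set
Position = List ℕ

-- A possibly infinite tree is a partial labelling of positions, defined at the
-- root and, below a node labelled ℓ, exactly at the children 0, …, arity ℓ - 1.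
-- The division into pre-types and pre-session types is imposed further down.
record Tree : Set where
  field
    lab       : Position → Maybe Label
    rooted    : Is-just (lab [])
    branching : ∀ p i → Is-just (lab (p ∷ʳ i)) ⇔ Maybe.Any (λ ℓ → i < arity ℓ) (lab p)

open Tree public

-- Equality of trees.
infix 4 _≈_
record _≈_ (t s : Tree) : Set where
  constructor mk≈
  field
    at : ∀ p → lab t p ≡ lab s p

open _≈_ public

-- s ⊑ t: s is the sub-tree of t at some position p (s being rooted, p is
-- necessarily a position of t).
infix 4 _⊑_
_⊑_ : Tree → Tree → Set
s ⊑ t = ∃[ p ] ∀ q → lab s q ≡ lab t (p ++ q)

labChildren : ∀ {k} → Vec Tree k → ℕ → Position → Maybe Label
labChildren []       _       _ = nothing
labChildren (t ∷ _)  zero    p = lab t p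
labChildren (_ ∷ ts) (suc i) p = labChildren ts i p

labChildren-root : ∀ {k} (ts : Vec Tree k) i → Is-just (labChildren ts i []) ⇔ i < k
labChildren-root []       _    = mk⇔ (λ ()) (λ ())
labChildren-root (t ∷ _)  zero = mk⇔ (λ _ → s≤s z≤n) (λ _ → rooted t)
labChildren-root (_ ∷ ts) (suc i) =
  mk⇔ (λ j → s≤s (Equivalence.to ih j)) (λ { (s≤s i<k) → Equivalence.from ih i<k })
  where ih = labChildren-root ts i

labChildren-branching : ∀ {k} (ts : Vec Tree k) j p i →
  Is-just (labChildren ts j (p ∷ʳ i)) ⇔ Maybe.Any (λ ℓ → i < arity ℓ) (labChildren ts j p)
labChildren-branching []       _       _ _ = mk⇔ (λ ()) (λ ())
labChildren-branching (t ∷ _)  zero    p i = branching t p i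
labChildren-branching (_ ∷ ts) (suc j) p i = labChildren-branching ts j p i

node : (ℓ : Label) → Vec Tree (arity ℓ) → Tree
lab (node ℓ ts) []       = just ℓ
lab (node ℓ ts) (i ∷ p)  = labChildren ts i p
rooted (node ℓ ts)       = Maybe.just tt
branching (node ℓ ts) [] i =
  mk⇔ (λ j → Maybe.just (Equivalence.to (labChildren-root ts i) j))
      (λ { (Maybe.just i<k) → Equivalence.from (labChildren-root ts i) i<k })
branching (node ℓ ts) (j ∷ p) i = labChildren-branching ts j p i

infixr 5 _⇒_ _⊸_
infixr 6 _⊗_
infix  8 ●_

basic : Basic → Tree
basic B = node (basicˡ B) []

end : Tree
end = node endˡ []

-- input t T is ?t.T and output t T is !t.T
input output : Tree → Tree → Tree
input  t T = node inˡ  (t ∷ T ∷ [])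
output t T = node outˡ (t ∷ T ∷ [])

⟨_⟩ : Tree → Tree
⟨ T ⟩ = node chanˡ (T ∷ [])

_⊗_ _⇒_ _⊸_ : Tree → Tree → Tree
t ⊗ s = node prodˡ  (t ∷ s ∷ [])
t ⇒ s = node funˡ   (t ∷ s ∷ [])
t ⊸ s = node lolliˡ (t ∷ s ∷ [])

IO ●_ : Tree → Tree
IO t = node ioˡ (t ∷ [])
● t  = node bulletˡ (t ∷ [])

●^ : ℕ → Tree → Tree
●^ zero    t = t
●^ (suc n) t = ● ●^ n t

-- Pre-types and types --------------------------------------------------------

data Sort : Set where
  type session : Sort

-- One unfolding of the grammar of pre-types and pre-session types, with R in
-- place of the recursive occurrences.
data Grammar (R : Sort → Tree → Set) : Sort → Tree → Set where
  basicᵍ   : ∀ {r B}   → r ≈ basic B                                → Grammar R type r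
  sessionᵍ : ∀ {r}     → Grammar R session r                        → Grammar R type r
  chanᵍ    : ∀ {r T}   → r ≈ ⟨ T ⟩ → R session T                    → Grammar R type r
  prodᵍ    : ∀ {r t s} → r ≈ t ⊗ s → R type t → R type s            → Grammar R type r
  funᵍ     : ∀ {r t s} → r ≈ t ⇒ s → R type t → R type s            → Grammar R type r
  lolliᵍ   : ∀ {r t s} → r ≈ t ⊸ s → R type t → R type s            → Grammar R type r
  ioᵍ      : ∀ {r t}   → r ≈ IO t → R type t                        → Grammar R type r
  bulletᵍ  : ∀ {r t}   → r ≈ ● t → R type t                         → Grammar R type r
  endᵍ     : ∀ {r}     → r ≈ end                                    → Grammar R session r
  inputᵍ   : ∀ {r t T} → r ≈ input t T → R type t → R session T     → Grammar R session r
  outputᵍ  : ∀ {r t T} → r ≈ output t T → R type t → R session T    → Grammar R session r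
  sbulletᵍ : ∀ {r T}   → r ≈ ● T → R session T                      → Grammar R session r

-- Being generated coinductively is being generated down to every finite depth:
-- the children of a node are determined by the node, so the greatest fixed
-- point of Grammar is the intersection of its finite approximations.
GeneratedTo : ℕ → Sort → Tree → Set
GeneratedTo zero    _ _ = ⊤
GeneratedTo (suc d) σ t = Grammar (GeneratedTo d) σ t

PreType PreSession : Tree → Set
PreType    t = ∀ d → GeneratedTo d type t
PreSession T = ∀ d → GeneratedTo d session T

data Lin : Tree → Set where
  lin-input  : ∀ {r t T} → r ≈ input t T        → Lin r
  lin-output : ∀ {r t T} → r ≈ output t T       → Lin r
  lin-⊸      : ∀ {r t s} → r ≈ t ⊸ s            → Lin r
  lin-IO     : ∀ {r t}   → r ≈ IO t             → Lin r
  lin-⊗ˡ     : ∀ {r t s} → r ≈ t ⊗ s → Lin t    → Lin r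
  lin-⊗ʳ     : ∀ {r t s} → r ≈ t ⊗ s → Lin s    → Lin r
  lin-●      : ∀ {r t}   → r ≈ ● t → Lin t      → Lin r

Un : Tree → Set
Un t = ¬ Lin t

-- A function π : ℕ → ℕ all of whose finite prefixes are positions of t is an
-- infinite path of t.
record WellFormed (t : Tree) : Set where
  field
    fun-un     : ∀ {t₁ t₂} → t₁ ⇒ t₂ ⊑ t → Un t₂ → Un t₁
    lolli-lin  : ∀ {t₁ t₂} → t₁ ⊸ t₂ ⊑ t → Lin t₂
    regular    : ∃[ ts ] ∀ s → s ⊑ t → Any (s ≈_) ts
    guarded    : ∀ (π : ℕ → ℕ) → (∀ n → Is-just (lab t (applyUpTo π n))) →
                 ∀ n → ∃[ m ] n ≤ m × lab t (applyUpTo π m) ≡ just bulletˡ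

IsType IsSessionType : Tree → Set
IsType        t = PreType t × WellFormed t
IsSessionType T = PreSession T × WellFormed T

-- Expressions ----------------------------------------------------------------

-- Expressions up to renaming of bound variables, in well-scoped de Bruijn form:
-- Expr n has its free variables among n given ones.  Channels are not bound by
-- expressions and are drawn from ℕ.

data Polarity : Set where
  pos neg : Polarity

data Name (n : ℕ) : Set where
  var      : Fin n → Name n
  chan     : ℕ → Name n
  endpoint : ℕ → Polarity → Name n

data Const : Set where
  unit pair open′ send recv future return bind : Const

data Expr (n : ℕ) : Set where
  con   : Const → Expr n
  name  : Name n → Expr n
  lam   : Expr (suc n) → Expr n
  _·_   : Expr n → Expr n → Expr n
  -- split e f is "split e as x,y in f"; in f, y is variable 0 and x variable 1.
  split : Expr n → Expr (suc (suc n)) → Expr n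

infixl 7 _·_

renameName : ∀ {m n} → (Fin m → Fin n) → Name m → Name n
renameName ρ (var x)        = var (ρ x)
renameName ρ (chan a)       = chan a
renameName ρ (endpoint a p) = endpoint a p

liftᵣ : ∀ {m n} → (Fin m → Fin n) → Fin (suc m) → Fin (suc n)
liftᵣ ρ zero    = zero
liftᵣ ρ (suc x) = suc (ρ x)

rename : ∀ {m n} → (Fin m → Fin n) → Expr m → Expr n
rename ρ (con k)     = con k
rename ρ (name u)    = name (renameName ρ u)
rename ρ (lam e)     = lam (rename (liftᵣ ρ) e)
rename ρ (e · f)     = rename ρ e · rename ρ f
rename ρ (split e f) = split (rename ρ e) (rename (liftᵣ (liftᵣ ρ)) f)

liftₛ : ∀ {m n} → (Fin m → Expr n) → Fin (suc m) → Expr (suc n)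
liftₛ σ zero    = name (var zero)
liftₛ σ (suc x) = rename suc (σ x)

subst : ∀ {m n} → (Fin m → Expr n) → Expr m → Expr n
subst σ (con k)               = con k
subst σ (name (var x))        = σ x
subst σ (name (chan a))       = name (chan a)
subst σ (name (endpoint a p)) = name (endpoint a p)
subst σ (lam e)               = lam (subst (liftₛ σ) e)
subst σ (e · f)               = subst σ e · subst σ f
subst σ (split e f)           = split (subst σ e) (subst (liftₛ (liftₛ σ)) f)

-- σ ∷ₛ f instantiates variable 0 with f and the others according to σ.
_∷ₛ_ : ∀ {m n} → (Fin m → Expr n) → Expr n → Fin (suc m) → Expr n
(σ ∷ₛ f) zero    = f
(σ ∷ₛ f) (suc x) = σ x

idₛ : ∀ {n} → Fin n → Expr n
idₛ x = name (var x)

_[_] : ∀ {n} → Expr (suc n) → Expr n → Expr n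
e [ f ] = subst (idₛ ∷ₛ f) e

-- f [ e₁ , e₂ ]₂ is f{e₁,e₂/x,y}.
_[_,_]₂ : ∀ {n} → Expr (suc (suc n)) → Expr n → Expr n → Expr n
f [ e₁ , e₂ ]₂ = subst ((idₛ ∷ₛ e₁) ∷ₛ e₂) f

data ECtx (n : ℕ) : Set where
  hole   : ECtx n
  appᶜ   : ECtx n → Expr n → ECtx n
  splitᶜ : ECtx n → Expr (suc (suc n)) → ECtx n
  openᶜ sendᶜ recvᶜ bindᶜ : ECtx n → ECtx n

plug : ∀ {n} → ECtx n → Expr n → Expr n
plug hole         e = e
plug (appᶜ E f)   e = plug E e · f
plug (splitᶜ E f) e = split (plug E e) f
plug (openᶜ E)    e = con open′ · plug E e
plug (sendᶜ E)    e = con send · plug E e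
plug (recvᶜ E)    e = con recv · plug E e
plug (bindᶜ E)    e = con bind · plug E e

infix 4 _⟶_
data _⟶_ {n : ℕ} : Expr n → Expr n → Set where
  β       : ∀ {e f} → lam e · f ⟶ e [ f ]
  β-bind  : ∀ {e f} → con bind · (con return · e) · f ⟶ f · e
  β-split : ∀ {e₁ e₂ f} → split (con pair · e₁ · e₂) f ⟶ f [ e₁ , e₂ ]₂
  ctx     : ∀ (E : ECtx n) {e f} → e ⟶ f → plug E e ⟶ plug E f

-- Types of constants ---------------------------------------------------------

data _∈types_ : Tree → Const → Set where
  unitᵏ   : basic Unit ∈types unit
  returnᵏ : ∀ {t} → IsType t → t ⇒ IO t ∈types return
  openᵏ   : ∀ {T} → IsSessionType T → ⟨ T ⟩ ⇒ IO T ∈types open′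
  sendᵏ   : ∀ {t T} → IsType t → IsSessionType T →
            output t T ⇒ t ⊸ IO T ∈types send
  recvᵏ   : ∀ {t T} → IsType t → IsSessionType T →
            input t T ⇒ IO (t ⊗ T) ∈types recv
  futureᵏ : ∀ n {t} → IsType t → ●^ n (IO t) ⇒ IO (●^ n t) ∈types future
  pairˡ   : ∀ {t s} → IsType t → IsType s → Lin t → t ⇒ s ⊸ t ⊗ s ∈types pair
  pairᵘ   : ∀ {t s} → IsType t → IsType s → Un t → t ⇒ s ⇒ t ⊗ s ∈types pair
  bindᵏ   : ∀ {t s} → IsType t → IsType s →
            IO t ⇒ (t ⊸ IO s) ⊸ IO s ∈types bind

infix 4 _∈types_

-- Typing environments --------------------------------------------------------

Admissible : ∀ {n} → Name n → Tree → Set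
Admissible (var _)        t = IsType t
Admissible (chan _)       t = ∃[ T ] IsSessionType T × t ≈ ⟨ T ⟩
Admissible (endpoint _ _) t = IsSessionType t

record Env (n : ℕ) : Set where
  field
    lookup     : Name n → Maybe Tree
    admissible : ∀ u {t} → lookup u ≡ just t → Admissible u t
    finite     : ∃[ us ] ∀ u → Is-just (lookup u) → u ∈ us

open Env public

_∈dom_ _∉dom_ : ∀ {n} → Name n → Env n → Set
u ∈dom Γ = Is-just (lookup Γ u)
u ∉dom Γ = ¬ u ∈dom Γ

LinEnv UnEnv : ∀ {n} → Env n → Set
LinEnv Γ = ∃[ u ] ∃[ t ] lookup Γ u ≡ just t × Lin t
UnEnv  Γ = ¬ LinEnv Γ

infix 4 _∋_∶_
_∋_∶_ : ∀ {n} → Env n → Name n → Tree → Set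
Γ ∋ u ∶ t = Pointwise _≈_ (lookup Γ u) (just t)

-- Equality of finite maps, up to equality of trees.
infix 4 _≐_
_≐_ : ∀ {n} → Env n → Env n → Set
Γ ≐ Δ = ∀ u → Pointwise _≈_ (lookup Γ u) (lookup Δ u)

-- Δ ≐ Γ , u ∶ t: the extension Γ,u:t is defined (u is not in Γ) and equals Δ.
infix 4 _≐_,_∶_
record _≐_,_∶_ {n} (Δ Γ : Env n) (u : Name n) (t : Tree) : Set where
  field
    fresh : u ∉dom Γ
    this  : Δ ∋ u ∶ t
    rest  : ∀ v → v ≢ u → Pointwise _≈_ (lookup Δ v) (lookup Γ v)

-- Γ +₁ u ∶ t ↦ Δ: the sum Γ + u:t is defined and equals Δ.
infix 4 _+₁_∶_↦_
data _+₁_∶_↦_ {n} (Γ : Env n) (u : Name n) (t : Tree) (Δ : Env n) : Set where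
  add  : Δ ≐ Γ , u ∶ t → Γ +₁ u ∶ t ↦ Δ
  keep : Γ ∋ u ∶ t → Un t → Γ ≐ Δ → Γ +₁ u ∶ t ↦ Δ

-- Γ + Γ′ ↦ Δ: the sum Γ + Γ′ is defined and equals Δ.
infix 4 _+_↦_
data _+_↦_ {n} (Γ : Env n) : Env n → Env n → Set where
  +∅ : ∀ {∅ Δ} → (∀ u → u ∉dom ∅) → Γ ≐ Δ → Γ + ∅ ↦ Δ
  +, : ∀ {Γ′ Γ″ u t Δ Δ′} → Γ″ ≐ Γ′ , u ∶ t →
       Γ + Γ′ ↦ Δ → Δ +₁ u ∶ t ↦ Δ′ → Γ + Γ″ ↦ Δ′

-- Γ ▹ t: the environment Γ,x:t for a new variable x, which becomes variable 0.
lookup▹ : ∀ {n} → Env n → Tree → Name (suc n) → Maybe Tree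
lookup▹ Γ t (var zero)     = just t
lookup▹ Γ t (var (suc x))  = lookup Γ (var x)
lookup▹ Γ t (chan a)       = lookup Γ (chan a)
lookup▹ Γ t (endpoint a p) = lookup Γ (endpoint a p)

infixl 6 _▹_given_
_▹_given_ : ∀ {n} → Env n → (t : Tree) → IsType t → Env (suc n)
lookup (Γ ▹ t given _) = lookup▹ Γ t
admissible (Γ ▹ t given ok) (var zero)     refl = ok
admissible (Γ ▹ t given ok) (var (suc x))  eq   = admissible Γ (var x) eq
admissible (Γ ▹ t given ok) (chan a)       eq   = admissible Γ (chan a) eq
admissible (Γ ▹ t given ok) (endpoint a p) eq   = admissible Γ (endpoint a p) eq
finite (Γ ▹ t given _) = var zero ∷ map (renameName suc) (proj₁ (finite Γ)) , λ
  { (var zero)     _ → here refl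
  ; (var (suc x))  j → there (∈-map⁺ (renameName suc) (proj₂ (finite Γ) (var x) j))
  ; (chan a)       j → there (∈-map⁺ (renameName suc) (proj₂ (finite Γ) (chan a) j))
  ; (endpoint a p) j → there (∈-map⁺ (renameName suc) (proj₂ (finite Γ) (endpoint a p) j))
  }

-- Typing of expressions ------------------------------------------------------

-- Only types occur in derivations: environments hold types by construction, the
-- premises IsType below cover the types introduced by a rule, and all other
-- trees are sub-trees of types already present.  The rule ≈-conv expresses that
-- types are identified when they are equal as trees; it has no other content.
infix 3 _⊢_∶_
data _⊢_∶_ {n} : Env n → Expr n → Tree → Set where
  ≈-conv : ∀ {Γ e t t′} → t ≈ t′ → Γ ⊢ e ∶ t → Γ ⊢ e ∶ t′

  ●I    : ∀ {Γ e t} → Γ ⊢ e ∶ t → Γ ⊢ e ∶ ● t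

  const : ∀ {Γ k t} → UnEnv Γ → t ∈types k → Γ ⊢ con k ∶ t

  axiom : ∀ {Γ Δ u t} → Δ ≐ Γ , u ∶ t → UnEnv Γ → Δ ⊢ name u ∶ t

  ⇒I    : ∀ m {Γ e t s} → IsType (t ⇒ s) → (ok : IsType (●^ m t)) →
          Γ ▹ ●^ m t given ok ⊢ e ∶ ●^ m s → UnEnv Γ →
          Γ ⊢ lam e ∶ ●^ m (t ⇒ s)

  ⊸I    : ∀ m {Γ e t s} → IsType (t ⊸ s) → (ok : IsType (●^ m t)) →
          Γ ▹ ●^ m t given ok ⊢ e ∶ ●^ m s →
          Γ ⊢ lam e ∶ ●^ m (t ⊸ s)

  ⇒E    : ∀ m {Γ Γ₁ Γ₂ e₁ e₂ t s} →
          Γ₁ ⊢ e₁ ∶ ●^ m (t ⇒ s) → Γ₂ ⊢ e₂ ∶ ●^ m t → Γ₁ + Γ₂ ↦ Γ →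
          Γ ⊢ e₁ · e₂ ∶ ●^ m s

  ⊸E    : ∀ m {Γ Γ₁ Γ₂ e₁ e₂ t s} →
          Γ₁ ⊢ e₁ ∶ ●^ m (t ⊸ s) → Γ₂ ⊢ e₂ ∶ ●^ m t → Γ₁ + Γ₂ ↦ Γ →
          Γ ⊢ e₁ · e₂ ∶ ●^ m s

  ⊗E    : ∀ m {Γ Γ₁ Γ₂ e f t₁ t₂ s} →
          Γ₁ ⊢ e ∶ ●^ m (t₁ ⊗ t₂) →
          (ok₁ : IsType (●^ m t₁)) (ok₂ : IsType (●^ m t₂)) →
          Γ₂ ▹ ●^ m t₁ given ok₁ ▹ ●^ m t₂ given ok₂ ⊢ f ∶ ●^ m s → Γ₁ + Γ₂ ↦ Γ →
          Γ ⊢ split e f ∶ ●^ m s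

{-# OPTIONS --safe #-}
module Submission where

-- Typing is preserved because reduction replaces variables by expressions of
-- the same type, up to two difficulties: delays and linear resources.
--
-- Delays.  In a redex (λ x. e) f the abstraction may be typed with x and e at
-- level ●^ l and then be delayed by j more bullets, so that f has a type
-- ●^ (j + l) t while the body expects x : ●^ l t.  The substitution lemma
-- `substitute` therefore lets every image be typed j bullets later than the
-- name it replaces, and types the result j bullets later.  This works because
-- every introduction and elimination rule has a level, to which j can be added.
--
-- Resources.  The environment of the result has to be divided between the
-- premises of a rule in the way the original environment was.  The division is
-- governed by assigning to each name of the target the name of the source on
-- whose behalf it is used, its owner; names of unrestricted type may instead be
-- shared by everybody.  When the owner lies in both summands, it has an
-- unrestricted type, and then its image uses unrestricted names only
-- (`un⇒allUn`), which both premises may use.  That fact is where the linearity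
-- conditions on arrows enter: an application of unrestricted type can have
-- neither a linear argument nor a linear function.
--
-- Substitution under a binder needs renaming, and at a variable it needs
-- weakening.  Both are instances of the same traversal with names as images, so
-- the traversal is carried out over an abstract judgement for the images and
-- used twice.
--
-- The redexes are then taken apart by inversion.  A tree ●^ k t whose t does not
-- begin with a bullet determines k and t, so the levels at which two parts of a
-- redex are typed can be compared.

open import Data.Bool.Base using (Bool; true; false; not; _∨_)
open import Data.Fin.Base using (Fin; zero; suc)
import Data.Fin.Properties as Fin
open import Data.List.Base using ([]; _∷_; _++_; applyUpTo)
open import Data.List.Membership.Propositional using (_∈_)
open import Data.List.Properties using (++-assoc)
open import Data.List.Relation.Unary.Any using (here; there)
open import Data.Maybe using (Is-just)
open import Data.Maybe.Base using (Maybe; just; nothing; is-just)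
import Data.Maybe.Base as Maybe
open import Data.Maybe.Relation.Binary.Pointwise using (Pointwise; just; nothing)
open import Data.Maybe.Relation.Unary.Any using (just)
open import Data.Nat.Base using (ℕ; zero; suc; _+_)
import Data.Nat.Properties as ℕ
open import Data.Product.Base using (∃-syntax; _×_; _,_; proj₁; proj₂)
open import Data.Sum.Base using (_⊎_; inj₁; inj₂)
open import Data.Unit.Base using (tt)
open import Data.Vec.Base using (Vec; []; _∷_)
open import Data.Vec.Relation.Unary.All using (All; []; _∷_)
open import Relation.Binary.Definitions using (DecidableEquality)
import Relation.Binary.PropositionalEquality as Eq
open import Relation.Binary.PropositionalEquality
  using (_≡_; _≢_; refl; sym; trans; cong; cong₂; module ≡-Reasoning)
open import Relation.Nullary using (¬_; yes; no; does; contradiction)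
open import Defs

variable
  m n : ℕ

-- Trees

≈-refl : ∀ {t} → t ≈ t
≈-refl .at _ = refl

≈-sym : ∀ {t s} → t ≈ s → s ≈ t
≈-sym eq .at p = sym (eq .at p)

≈-trans : ∀ {t s r} → t ≈ s → s ≈ r → t ≈ r
≈-trans eq eq′ .at p = trans (eq .at p) (eq′ .at p)

≡⇒≈ : ∀ {t s} → t ≡ s → t ≈ s
≡⇒≈ refl = ≈-refl

●-cong : ∀ {t s} → t ≈ s → ● t ≈ ● s
●-cong eq .at []          = refl
●-cong eq .at (zero ∷ p)  = eq .at p
●-cong eq .at (suc _ ∷ _) = refl

●-injective : ∀ {t s} → ● t ≈ ● s → t ≈ s
●-injective eq .at p = eq .at (0 ∷ p)

●^-cong : ∀ k {t s} → t ≈ s → ●^ k t ≈ ●^ k s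
●^-cong zero    eq = eq
●^-cong (suc k) eq = ●-cong (●^-cong k eq)

●^-+ : ∀ j k t → ●^ (j + k) t ≡ ●^ j (●^ k t)
●^-+ zero    k t = refl
●^-+ (suc j) k t = cong ●_ (●^-+ j k t)

-- Only for such trees is the number of bullets in front well determined.
Undelayed : Tree → Set
Undelayed t = lab t [] ≢ just bulletˡ

●^-injective : ∀ j k {t s} → Undelayed t → Undelayed s →
  ●^ j t ≈ ●^ k s → j ≡ k × t ≈ s
●^-injective zero    zero    _  _  eq = refl , eq
●^-injective zero    (suc _) ut _  eq = contradiction (eq .at []) ut
●^-injective (suc _) zero    _  us eq = contradiction (sym (eq .at [])) us
●^-injective (suc j) (suc k) ut us eq with ●^-injective j k ut us (●-injective eq)
... | refl , t≈s = refl , t≈s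

data Arrow : Set where
  unrestricted linear : Arrow

arrow : Arrow → Tree → Tree → Tree
arrow unrestricted t s = t ⇒ s
arrow linear       t s = t ⊸ s

arrow-undelayed : ∀ α {t s} → Undelayed (arrow α t s)
arrow-undelayed unrestricted ()
arrow-undelayed linear       ()

-- The two arrows have different root labels, so equal trees also have equal arrows.
arrow-injective : ∀ α β {t s t′ s′} → arrow α t s ≈ arrow β t′ s′ → t ≈ t′ × s ≈ s′
arrow-injective unrestricted unrestricted eq = mk≈ (λ p → eq .at (0 ∷ p)) , mk≈ (λ p → eq .at (1 ∷ p))
arrow-injective linear       linear       eq = mk≈ (λ p → eq .at (0 ∷ p)) , mk≈ (λ p → eq .at (1 ∷ p))
arrow-injective unrestricted linear       eq = contradiction (eq .at []) λ ()
arrow-injective linear       unrestricted eq = contradiction (eq .at []) λ ()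

⊗-injective : ∀ {t s t′ s′} → t ⊗ s ≈ t′ ⊗ s′ → t ≈ t′ × s ≈ s′
⊗-injective eq = mk≈ (λ p → eq .at (0 ∷ p)) , mk≈ (λ p → eq .at (1 ∷ p))

⊗-cong : ∀ {t s t′ s′} → t ≈ t′ → s ≈ s′ → t ⊗ s ≈ t′ ⊗ s′
⊗-cong eq eq′ .at []                = refl
⊗-cong eq eq′ .at (zero ∷ p)        = eq .at p
⊗-cong eq eq′ .at (suc zero ∷ p)    = eq′ .at p
⊗-cong eq eq′ .at (suc (suc _) ∷ p) = refl

IO-injective : ∀ {t s} → IO t ≈ IO s → t ≈ s
IO-injective eq .at p = eq .at (0 ∷ p)

-- Linearity

Lin-resp : ∀ {t s} → t ≈ s → Lin t → Lin s
Lin-resp eq (lin-input eq′)  = lin-input  (≈-trans (≈-sym eq) eq′)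
Lin-resp eq (lin-output eq′) = lin-output (≈-trans (≈-sym eq) eq′)
Lin-resp eq (lin-⊸ eq′)      = lin-⊸      (≈-trans (≈-sym eq) eq′)
Lin-resp eq (lin-IO eq′)     = lin-IO     (≈-trans (≈-sym eq) eq′)
Lin-resp eq (lin-⊗ˡ eq′ l)   = lin-⊗ˡ     (≈-trans (≈-sym eq) eq′) l
Lin-resp eq (lin-⊗ʳ eq′ l)   = lin-⊗ʳ     (≈-trans (≈-sym eq) eq′) l
Lin-resp eq (lin-● eq′ l)    = lin-●      (≈-trans (≈-sym eq) eq′) l

Un-resp : ∀ {t s} → t ≈ s → Un t → Un s
Un-resp eq un l = un (Lin-resp (≈-sym eq) l)

Lin-●⁻ : ∀ {t} → Lin (● t) → Lin t
Lin-●⁻ (lin-● eq l)   = Lin-resp (≈-sym (●-injective eq)) l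
Lin-●⁻ (lin-input eq) = contradiction (eq .at []) λ ()
Lin-●⁻ (lin-output eq) = contradiction (eq .at []) λ ()
Lin-●⁻ (lin-⊸ eq) = contradiction (eq .at []) λ ()
Lin-●⁻ (lin-IO eq) = contradiction (eq .at []) λ ()
Lin-●⁻ (lin-⊗ˡ eq _) = contradiction (eq .at []) λ ()
Lin-●⁻ (lin-⊗ʳ eq _) = contradiction (eq .at []) λ ()

Lin-●^ : ∀ k {t} → Lin t → Lin (●^ k t)
Lin-●^ zero    l = l
Lin-●^ (suc k) l = lin-● ≈-refl (Lin-●^ k l)

Un-●^ : ∀ k {t} → Un t → Un (●^ k t)
Un-●^ zero    un = un
Un-●^ (suc k) un l = Un-●^ k un (Lin-●⁻ l)

Un-●^⁻ : ∀ k {t} → Un (●^ k t) → Un t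
Un-●^⁻ k un l = un (Lin-●^ k l)

Un-⇒ : ∀ {t s} → Un (t ⇒ s)
Un-⇒ (lin-input eq) = contradiction (eq .at []) λ ()
Un-⇒ (lin-output eq) = contradiction (eq .at []) λ ()
Un-⇒ (lin-⊸ eq) = contradiction (eq .at []) λ ()
Un-⇒ (lin-IO eq) = contradiction (eq .at []) λ ()
Un-⇒ (lin-⊗ˡ eq _) = contradiction (eq .at []) λ ()
Un-⇒ (lin-⊗ʳ eq _) = contradiction (eq .at []) λ ()
Un-⇒ (lin-● eq _) = contradiction (eq .at []) λ ()

Un-⊗ : ∀ {t s} → Un t → Un s → Un (t ⊗ s)
Un-⊗ ut us (lin-⊗ˡ eq l) = ut (Lin-resp (≈-sym (proj₁ (⊗-injective eq))) l)
Un-⊗ ut us (lin-⊗ʳ eq l) = us (Lin-resp (≈-sym (proj₂ (⊗-injective eq))) l)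
Un-⊗ ut us (lin-input eq) with eq .at []
... | ()
Un-⊗ ut us (lin-output eq) with eq .at []
... | ()
Un-⊗ ut us (lin-⊸ eq) with eq .at []
... | ()
Un-⊗ ut us (lin-IO eq) with eq .at []
... | ()
Un-⊗ ut us (lin-● eq _) with eq .at []
... | ()

-- Sub-trees and the linearity conditions on types

⊑-respʳ : ∀ {s s′} t → s ≈ s′ → t ⊑ s → t ⊑ s′
⊑-respʳ t eq (p , at-p) = p , λ q → trans (at-p q) (eq .at (p ++ q))

⊑-trans : ∀ t s r → t ⊑ s → s ⊑ r → t ⊑ r
⊑-trans t s r (p , t⊑s) (p′ , s⊑r) = p′ ++ p , λ q → begin
  lab t q               ≡⟨ t⊑s q ⟩
  lab s (p ++ q)        ≡⟨ s⊑r (p ++ q) ⟩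
  lab r (p′ ++ p ++ q)  ≡⟨ cong (lab r) (++-assoc p′ p q) ⟨
  lab r ((p′ ++ p) ++ q) ∎
  where open ≡-Reasoning

-- The two conditions of being a type that speak of linearity.  They pass to
-- sub-trees and are all that is used of the types assigned to expressions.
record Disciplined (t : Tree) : Set where
  field
    fun-un    : ∀ {t₁ t₂} → t₁ ⇒ t₂ ⊑ t → Un t₂ → Un t₁
    lolli-lin : ∀ {t₁ t₂} → t₁ ⊸ t₂ ⊑ t → Lin t₂

open Disciplined

wellFormed⇒disciplined : ∀ {t} → WellFormed t → Disciplined t
wellFormed⇒disciplined wf = record
  { fun-un = WellFormed.fun-un wf ; lolli-lin = WellFormed.lolli-lin wf }

disciplined-resp : ∀ {t s} → t ≈ s → Disciplined t → Disciplined s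
disciplined-resp eq d .fun-un    {t₁} {t₂} sub = fun-un d (⊑-respʳ (t₁ ⇒ t₂) (≈-sym eq) sub)
disciplined-resp eq d .lolli-lin {t₁} {t₂} sub = lolli-lin d (⊑-respʳ (t₁ ⊸ t₂) (≈-sym eq) sub)

disciplined-⊑ : ∀ {t s} → t ⊑ s → Disciplined s → Disciplined t
disciplined-⊑ {t} {s} t⊑s d .fun-un    {t₁} {t₂} sub = fun-un d (⊑-trans (t₁ ⇒ t₂) t s sub t⊑s)
disciplined-⊑ {t} {s} t⊑s d .lolli-lin {t₁} {t₂} sub = lolli-lin d (⊑-trans (t₁ ⊸ t₂) t s sub t⊑s)

nothing-unrooted : ∀ (t : Tree) → ¬ lab t [] ≡ nothing
nothing-unrooted t eq with lab t [] | rooted t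
nothing-unrooted t () | just _ | _

-- t is rooted, so i is the index of an existing child.
child-disciplined : ∀ {k} {ts : Vec Tree k} → All Disciplined ts → ∀ i t p →
  (∀ q → lab t q ≡ labChildren ts i (p ++ q)) → ∃[ s ] Disciplined s × t ⊑ s
child-disciplined []       i       t p eq = contradiction (eq []) (nothing-unrooted t)
child-disciplined (d ∷ ds) zero    t p eq = _ , d , p , eq
child-disciplined (d ∷ ds) (suc i) t p eq = child-disciplined ds i t p eq

disciplined-node : ∀ ℓ {ts} → All Disciplined ts →
  (∀ {t₁ t₂} → t₁ ⇒ t₂ ≈ node ℓ ts → Un t₂ → Un t₁) →
  (∀ {t₁ t₂} → t₁ ⊸ t₂ ≈ node ℓ ts → Lin t₂) →
  Disciplined (node ℓ ts)
disciplined-node ℓ ds funOk lolliOk .fun-un ([] , eq) un = funOk (mk≈ eq) un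
disciplined-node ℓ ds funOk lolliOk .fun-un {t₁} {t₂} (i ∷ p , eq) un
  with child-disciplined ds i (t₁ ⇒ t₂) p eq
... | _ , d , sub = fun-un d sub un
disciplined-node ℓ ds funOk lolliOk .lolli-lin ([] , eq) = lolliOk (mk≈ eq)
disciplined-node ℓ ds funOk lolliOk .lolli-lin {t₁} {t₂} (i ∷ p , eq)
  with child-disciplined ds i (t₁ ⊸ t₂) p eq
... | _ , d , sub = lolli-lin d sub

other-root-fun : ∀ {ℓ ts t₁ t₂} → ℓ ≢ funˡ → t₁ ⇒ t₂ ≈ node ℓ ts → ∀ {A : Set} → A
other-root-fun ne eq with eq .at []
... | refl = contradiction refl ne

other-root-lolli : ∀ {ℓ ts t₁ t₂} → ℓ ≢ lolliˡ → t₁ ⊸ t₂ ≈ node ℓ ts → ∀ {A : Set} → A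
other-root-lolli ne eq with eq .at []
... | refl = contradiction refl ne

disciplined-other : ∀ ℓ {ts} → ℓ ≢ funˡ → ℓ ≢ lolliˡ → All Disciplined ts →
  Disciplined (node ℓ ts)
disciplined-other ℓ ne ne′ ds =
  disciplined-node ℓ ds (λ eq → other-root-fun ne eq) (λ eq → other-root-lolli ne′ eq)

disciplined-⇒ : ∀ {t s} → Disciplined t → Disciplined s → (Un s → Un t) → Disciplined (t ⇒ s)
disciplined-⇒ dt ds un = disciplined-node funˡ (dt ∷ ds ∷ [])
  (λ eq u → let eqᵗ , eqˢ = arrow-injective unrestricted unrestricted eq in
            Un-resp (≈-sym eqᵗ) (un (Un-resp eqˢ u)))
  (λ eq → other-root-lolli (λ ()) eq)

disciplined-⊸ : ∀ {t s} → Disciplined t → Disciplined s → Lin s → Disciplined (t ⊸ s)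
disciplined-⊸ dt ds l = disciplined-node lolliˡ (dt ∷ ds ∷ [])
  (λ eq → other-root-fun (λ ()) eq)
  (λ eq → Lin-resp (≈-sym (proj₂ (arrow-injective linear linear eq))) l)

disciplined-IO : ∀ {t} → Disciplined t → Disciplined (IO t)
disciplined-IO d = disciplined-other ioˡ (λ ()) (λ ()) (d ∷ [])

disciplined-⊗ : ∀ {t s} → Disciplined t → Disciplined s → Disciplined (t ⊗ s)
disciplined-⊗ dt ds = disciplined-other prodˡ (λ ()) (λ ()) (dt ∷ ds ∷ [])

disciplined-⟨⟩ : ∀ {t} → Disciplined t → Disciplined ⟨ t ⟩
disciplined-⟨⟩ d = disciplined-other chanˡ (λ ()) (λ ()) (d ∷ [])

disciplined-● : ∀ {t} → Disciplined t → Disciplined (● t)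
disciplined-● d = disciplined-other bulletˡ (λ ()) (λ ()) (d ∷ [])

disciplined-●^ : ∀ k {t} → Disciplined t → Disciplined (●^ k t)
disciplined-●^ zero    d = d
disciplined-●^ (suc k) d = disciplined-● (disciplined-●^ k d)

⊑-●^ : ∀ k {t} → t ⊑ ●^ k t
⊑-●^ zero    = [] , λ _ → refl
⊑-●^ (suc k) {t} with ⊑-●^ k {t}
... | p , eq = 0 ∷ p , eq

disciplined-●^⁻ : ∀ k {t} → Disciplined (●^ k t) → Disciplined t
disciplined-●^⁻ k {t} = disciplined-⊑ {t} (⊑-●^ k)

disciplined-type : ∀ {t} → IsType t → Disciplined t
disciplined-type (_ , wf) = wellFormed⇒disciplined wf

disciplined-constant : ∀ {k t} → t ∈types k → Disciplined t
disciplined-constant unitᵏ = disciplined-other (basicˡ Unit) (λ ()) (λ ()) []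
disciplined-constant (returnᵏ t) =
  disciplined-⇒ dt (disciplined-IO dt) (λ un → contradiction (lin-IO ≈-refl) un)
  where dt = disciplined-type t
disciplined-constant (openᵏ (_ , wf)) =
  disciplined-⇒ (disciplined-⟨⟩ dT) (disciplined-IO dT) (λ un → contradiction (lin-IO ≈-refl) un)
  where dT = wellFormed⇒disciplined wf
disciplined-constant (sendᵏ t (_ , wf)) =
  disciplined-⇒ (disciplined-other outˡ (λ ()) (λ ()) (dt ∷ dT ∷ []))
    (disciplined-⊸ dt (disciplined-IO dT) (lin-IO ≈-refl))
    (λ un → contradiction (lin-⊸ ≈-refl) un)
  where dt = disciplined-type t
        dT = wellFormed⇒disciplined wf
disciplined-constant (recvᵏ t (_ , wf)) =
  disciplined-⇒ (disciplined-other inˡ (λ ()) (λ ()) (dt ∷ dT ∷ []))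
    (disciplined-IO (disciplined-⊗ dt dT))
    (λ un → contradiction (lin-IO ≈-refl) un)
  where dt = disciplined-type t
        dT = wellFormed⇒disciplined wf
disciplined-constant (futureᵏ k t) =
  disciplined-⇒ (disciplined-●^ k (disciplined-IO dt)) (disciplined-IO (disciplined-●^ k dt))
    (λ un → contradiction (lin-IO ≈-refl) un)
  where dt = disciplined-type t
disciplined-constant (pairˡ t s lin) =
  disciplined-⇒ dt (disciplined-⊸ ds (disciplined-⊗ dt ds) (lin-⊗ˡ ≈-refl lin))
    (λ un → contradiction (lin-⊸ ≈-refl) un)
  where dt = disciplined-type t
        ds = disciplined-type s
disciplined-constant (pairᵘ t s un) =
  disciplined-⇒ dt
    (disciplined-⇒ ds (disciplined-⊗ dt ds) (λ un⊗ l → un⊗ (lin-⊗ʳ ≈-refl l)))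
    (λ _ → un)
  where dt = disciplined-type t
        ds = disciplined-type s
disciplined-constant (bindᵏ t s) =
  disciplined-⇒ (disciplined-IO dt)
    (disciplined-⊸ (disciplined-⊸ dt (disciplined-IO ds) (lin-IO ≈-refl))
       (disciplined-IO ds) (lin-IO ≈-refl))
    (λ un → contradiction (lin-⊸ ≈-refl) un)
  where dt = disciplined-type t
        ds = disciplined-type s

-- Types are closed under delay

●-position : ∀ {t} i p → Is-just (lab (● t) (i ∷ p)) → i ≡ 0
●-position zero    p j = refl
●-position (suc i) p ()

-- An infinite path of ● t takes child 0 and goes on as a path of t.
wellFormed-● : ∀ {t} → WellFormed t → WellFormed (● t)
wellFormed-● {t} wf = record
  { fun-un    = fun-un disciplined
  ; lolli-lin = lolli-lin disciplined
  ; regular   = ● t ∷ proj₁ (regular wf) , λ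
      { s ([] , eq)        → here (mk≈ eq)
      ; s (zero ∷ p , eq)  → there (proj₂ (regular wf) s (p , eq))
      ; s (suc i ∷ p , eq) → contradiction (eq []) (nothing-unrooted s)
      }
  ; guarded   = λ π path k →
      let first i = ●-position (π 0) (applyUpTo (λ j → π (suc j)) i) (path (suc i))
          down i  = cong (λ z → lab (● t) (z ∷ applyUpTo (λ j → π (suc j)) i)) (first i)
          l , k≤l , bullet = guarded wf (λ j → π (suc j))
            (λ i → Eq.subst Is-just (down i) (path (suc i))) k
      in suc l , ℕ.m≤n⇒m≤1+n k≤l , trans (down l) bullet
  }
  where
  open WellFormed using (regular; guarded)
  disciplined = disciplined-● (wellFormed⇒disciplined wf)

isType-● : ∀ {t} → IsType t → IsType (● t)
isType-● (pre , wf) = (λ { zero → tt ; (suc d) → bulletᵍ ≈-refl (pre d) }) , wellFormed-● wf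

isType-●^ : ∀ k {t} → IsType t → IsType (●^ k t)
isType-●^ zero    ok = ok
isType-●^ (suc k) ok = isType-● (isType-●^ k ok)

-- Names

_≟_ : DecidableEquality (Name n)
var x        ≟ var y with x Fin.≟ y
... | yes refl = yes refl
... | no x≢y   = no λ { refl → x≢y refl }
chan a       ≟ chan b with a ℕ.≟ b
... | yes refl = yes refl
... | no a≢b   = no λ { refl → a≢b refl }
endpoint a p ≟ endpoint b q with a ℕ.≟ b | p ≟ₚ q
  where
  _≟ₚ_ : DecidableEquality Polarity
  pos ≟ₚ pos = yes refl
  pos ≟ₚ neg = no λ ()
  neg ≟ₚ pos = no λ ()
  neg ≟ₚ neg = yes refl
... | yes refl | yes refl = yes refl
... | no a≢b   | _        = no λ { refl → a≢b refl }
... | _        | no p≢q   = no λ { refl → p≢q refl }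
var _        ≟ chan _       = no λ ()
var _        ≟ endpoint _ _ = no λ ()
chan _       ≟ var _        = no λ ()
chan _       ≟ endpoint _ _ = no λ ()
endpoint _ _ ≟ var _        = no λ ()
endpoint _ _ ≟ chan _       = no λ ()

weakenName : Name n → Name (suc n)
weakenName = renameName suc

weakenName-injective : ∀ {u v : Name n} → weakenName u ≡ weakenName v → u ≡ v
weakenName-injective {u = var _}        {var _}        refl = refl
weakenName-injective {u = chan _}       {chan _}       refl = refl
weakenName-injective {u = endpoint _ _} {endpoint _ _} refl = refl

weakenName≢zero : ∀ (u : Name n) → weakenName u ≢ var zero
weakenName≢zero (var _) ()
weakenName≢zero (chan _) ()
weakenName≢zero (endpoint _ _) ()

data NameView {n} : Name (suc n) → Set where
  new : NameView (var zero)
  old : (u : Name n) → NameView (weakenName u)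

nameView : (u : Name (suc n)) → NameView u
nameView (var zero)     = new
nameView (var (suc x))  = old (var x)
nameView (chan a)       = old (chan a)
nameView (endpoint a p) = old (endpoint a p)

lookup-▹ : ∀ (Γ : Env n) {t} ok u → lookup (Γ ▹ t given ok) (weakenName u) ≡ lookup Γ u
lookup-▹ Γ ok (var x)        = refl
lookup-▹ Γ ok (chan a)       = refl
lookup-▹ Γ ok (endpoint a p) = refl

-- Environments

_≈ᵐ_ : Maybe Tree → Maybe Tree → Set
_≈ᵐ_ = Pointwise _≈_

≈ᵐ-refl : ∀ {a} → a ≈ᵐ a
≈ᵐ-refl {just _}  = just ≈-refl
≈ᵐ-refl {nothing} = nothing

≈ᵐ-sym : ∀ {a b} → a ≈ᵐ b → b ≈ᵐ a
≈ᵐ-sym (just eq) = just (≈-sym eq)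
≈ᵐ-sym nothing   = nothing

≈ᵐ-trans : ∀ {a b c} → a ≈ᵐ b → b ≈ᵐ c → a ≈ᵐ c
≈ᵐ-trans (just eq) (just eq′) = just (≈-trans eq eq′)
≈ᵐ-trans nothing   nothing    = nothing

AllUn : Env n → Set
AllUn Γ = ∀ u {t} → lookup Γ u ≡ just t → Un t

unEnv⁺ : (Γ : Env n) → AllUn Γ → UnEnv Γ
unEnv⁺ Γ all (u , t , eq , l) = all u eq l

unEnv⁻ : (Γ : Env n) → UnEnv Γ → AllUn Γ
unEnv⁻ Γ un u eq l = un (u , _ , eq , l)

-- The second side may hold additional entries, but only unrestricted ones: this is
-- the order along which typing can be weakened.
infix 4 _≼_ _≼ᴱ_
data _≼_ : Maybe Tree → Maybe Tree → Set where
  none  : nothing ≼ nothing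
  same  : ∀ {t s} → t ≈ s → just t ≼ just s
  extra : ∀ {s} → Un s → nothing ≼ just s

_≼ᴱ_ : Env n → Env n → Set
Γ ≼ᴱ Δ = ∀ u → lookup Γ u ≼ lookup Δ u

≼-refl : ∀ {a} → a ≼ a
≼-refl {just _}  = same ≈-refl
≼-refl {nothing} = none

≼-reflexive : ∀ {a b} → a ≡ b → a ≼ b
≼-reflexive refl = ≼-refl

-- The sum of environments at a single name.  Unlike the definition by successive
-- insertions it is symmetric and independent of an order of the entries.
infix 4 _⊞_↦_
data _⊞_↦_ : Maybe Tree → Maybe Tree → Maybe Tree → Set where
  none  : nothing ⊞ nothing ↦ nothing
  left  : ∀ {t r} → t ≈ r → just t ⊞ nothing ↦ just r
  right : ∀ {s r} → s ≈ r → nothing ⊞ just s ↦ just r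
  both  : ∀ {t s r} → t ≈ r → s ≈ r → Un r → just t ⊞ just s ↦ just r

Sum : Env n → Env n → Env n → Set
Sum Γ Γ′ Δ = ∀ u → lookup Γ u ⊞ lookup Γ′ u ↦ lookup Δ u

⊞-comm : ∀ {a b c} → a ⊞ b ↦ c → b ⊞ a ↦ c
⊞-comm none           = none
⊞-comm (left eq)      = right eq
⊞-comm (right eq)     = left eq
⊞-comm (both eq eq′ un) = both eq′ eq un

⊞-resp : ∀ {a b c b′ c′} → b ≈ᵐ b′ → c ≈ᵐ c′ → a ⊞ b ↦ c → a ⊞ b′ ↦ c′
⊞-resp nothing nothing none = none
⊞-resp nothing (just c) (left eq) = left (≈-trans eq c)
⊞-resp (just b) (just c) (right eq) = right (≈-trans (≈-sym b) (≈-trans eq c))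
⊞-resp (just b) (just c) (both eq eq′ un) =
  both (≈-trans eq c) (≈-trans (≈-sym b) (≈-trans eq′ c)) (Un-resp c un)

⊞-identityʳ : ∀ {a c} → a ≈ᵐ c → a ⊞ nothing ↦ c
⊞-identityʳ (just eq) = left eq
⊞-identityʳ nothing   = none

⊞-identityʳ⁻ : ∀ {a b c} → b ≡ nothing → a ⊞ b ↦ c → a ≈ᵐ c
⊞-identityʳ⁻ refl none      = nothing
⊞-identityʳ⁻ refl (left eq) = just eq

not-just : {A : Set} {a : Maybe A} → ¬ Is-just a → a ≡ nothing
not-just {a = just _}  ¬j = contradiction (just tt) ¬j
not-just {a = nothing} ¬j = refl

+↦⇒Sum : ∀ {Γ Γ′ Δ : Env n} → Γ + Γ′ ↦ Δ → Sum Γ Γ′ Δ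
+↦⇒Sum {Γ = Γ} (+∅ {∅} empty Γ≐Δ) u =
  Eq.subst (λ b → lookup Γ u ⊞ b ↦ _) (sym (not-just (empty u))) (⊞-identityʳ (Γ≐Δ u))
+↦⇒Sum (+, {u = u} Γ″≐ sum step) v with u ≟ v
+↦⇒Sum (+, {u = u} Γ″≐ sum (add Δ′≐)) v | no u≢v =
  ⊞-resp (≈ᵐ-sym (rest Γ″≐ v (λ { refl → u≢v refl }))) (≈ᵐ-sym (rest Δ′≐ v (λ { refl → u≢v refl })))
    (+↦⇒Sum sum v)
  where open _≐_,_∶_
+↦⇒Sum (+, {u = u} Γ″≐ sum (keep _ _ Δ≐)) v | no u≢v =
  ⊞-resp (≈ᵐ-sym (rest Γ″≐ v (λ { refl → u≢v refl }))) (Δ≐ v) (+↦⇒Sum sum v)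
  where open _≐_,_∶_
+↦⇒Sum (+, {u = u} Γ″≐ sum (add Δ′≐)) v | yes refl =
  new-entry (⊞-absent (not-just (fresh Γ″≐)) (not-just (fresh Δ′≐)) (+↦⇒Sum sum u))
    (this Γ″≐) (this Δ′≐)
  where
  open _≐_,_∶_
  ⊞-absent : ∀ {a b c} → b ≡ nothing → c ≡ nothing → a ⊞ b ↦ c → a ≈ᵐ nothing
  ⊞-absent refl refl none = nothing
  new-entry : ∀ {a b c t} → a ≈ᵐ nothing → b ≈ᵐ just t → c ≈ᵐ just t → a ⊞ b ↦ c
  new-entry nothing (just eq) (just eq′) = right (≈-trans eq (≈-sym eq′))
+↦⇒Sum (+, {u = u} Γ″≐ sum (keep Δ∋u un Δ≐)) v | yes refl =
  kept (⊞-identityʳ⁻ (not-just (fresh Γ″≐)) (+↦⇒Sum sum u)) Δ∋u (this Γ″≐) (Δ≐ u) un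
  where
  open _≐_,_∶_
  kept : ∀ {a b c d t} → a ≈ᵐ c → c ≈ᵐ just t → b ≈ᵐ just t → c ≈ᵐ d → Un t → a ⊞ b ↦ d
  kept (just ac) (just ct) (just bt) (just cd) un =
    both (≈-trans ac cd) (≈-trans bt (≈-trans (≈-sym ct) cd)) (Un-resp (≈-trans (≈-sym ct) cd) un)

mask : Bool → Maybe Tree → Maybe Tree
mask true  a = a
mask false a = nothing

mask-nothing : ∀ b → mask b nothing ≡ nothing
mask-nothing true  = refl
mask-nothing false = refl

mask-just : ∀ b {a t} → mask b a ≡ just t → a ≡ just t
mask-just true eq = eq

mask-Is-just : ∀ b {a} → Is-just (mask b a) → Is-just a
mask-Is-just true j = j

restrict : (Name n → Bool) → Env n → Env n
restrict b Γ .lookup u          = mask (b u) (lookup Γ u)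
restrict b Γ .admissible u eq   = admissible Γ u (mask-just (b u) eq)
restrict b Γ .finite            = proj₁ (finite Γ) , λ u j → proj₂ (finite Γ) u (mask-Is-just (b u) j)

_∖_ : Env n → Name n → Env n
Γ ∖ u = restrict (λ v → not (does (v ≟ u))) Γ

∖-here : ∀ (Γ : Env n) u → lookup (Γ ∖ u) u ≡ nothing
∖-here Γ u with u ≟ u
... | yes _  = refl
... | no u≢u = contradiction refl u≢u

∖-elsewhere : ∀ (Γ : Env n) {u} v → v ≢ u → lookup (Γ ∖ u) v ≡ lookup Γ v
∖-elsewhere Γ {u} v v≢u with v ≟ u
... | yes v≡u = contradiction v≡u v≢u
... | no _    = refl

just-or-nothing : (a : Maybe Tree) → (∃[ t ] a ≡ just t) ⊎ a ≡ nothing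
just-or-nothing (just t) = inj₁ (t , refl)
just-or-nothing nothing  = inj₂ refl

∖-extension : ∀ (Γ : Env n) {u t} → lookup Γ u ≈ᵐ just t → Γ ≐ Γ ∖ u , u ∶ t
∖-extension Γ {u} eq = record
  { fresh = λ j → absent (∖-here Γ u) j
  ; this  = eq
  ; rest  = λ v v≢u → Eq.subst (lookup Γ v ≈ᵐ_) (sym (∖-elsewhere Γ v v≢u)) ≈ᵐ-refl
  }
  where
  absent : {a : Maybe Tree} → a ≡ nothing → ¬ Is-just a
  absent refl ()

∖-bound : ∀ (Γ : Env n) {u us} → (∀ v → v ∈dom Γ → v ∈ u ∷ us) →
  ∀ v → v ∈dom (Γ ∖ u) → v ∈ us
∖-bound Γ {u} bound v j with v ≟ u
... | no v≢u with bound v j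
...   | here v≡u = contradiction v≡u v≢u
...   | there v∈ = v∈
∖-bound Γ {u} bound v () | yes _

≡⇒≈ᵐ : ∀ {a b} → a ≡ b → a ≈ᵐ b
≡⇒≈ᵐ refl = ≈ᵐ-refl

-- The entries of the second summand are inserted along a finite list of names that
-- bounds its domain.
Sum⇒+↦ : ∀ {Γ Γ′ Δ : Env n} → Sum Γ Γ′ Δ → Γ + Γ′ ↦ Δ
Sum⇒+↦ {Γ = Γ} {Γ′} {Δ} = go (proj₁ (finite Γ′)) Γ′ Δ (proj₂ (finite Γ′))
  where
  go : ∀ us Γ′ Δ → (∀ u → Is-just (lookup Γ′ u) → u ∈ us) → Sum Γ Γ′ Δ → Γ + Γ′ ↦ Δ
  go [] Γ′ Δ bound sum = +∅ empty (λ u → ⊞-identityʳ⁻ (not-just (empty u)) (sum u))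
    where
    empty : ∀ u → u ∉dom Γ′
    empty u j with bound u j
    ... | ()
  go (x ∷ us) Γ′ Δ bound sum with just-or-nothing (lookup Γ′ x)
  ... | inj₂ x∉ = go us Γ′ Δ bound′ sum
    where
    bound′ : ∀ u → Is-just (lookup Γ′ u) → u ∈ us
    bound′ u j with bound u j
    ... | there u∈ = u∈
    ... | here refl rewrite x∉ with j
    ...   | ()
  ... | inj₁ (t , x∈) with just-or-nothing (lookup Γ x)
  -- x comes from the second summand alone, so the sum lacks it before its insertion.
  ...   | inj₂ x∉Γ = +, (∖-extension Γ′ (≡⇒≈ᵐ x∈))
      (go us (Γ′ ∖ x) (Δ ∖ x) (∖-bound Γ′ bound) sum′)
      (add (∖-extension Δ (entry x∉Γ x∈ (sum x))))
    where
    entry : ∀ {a b c} → a ≡ nothing → b ≡ just t → a ⊞ b ↦ c → c ≈ᵐ just t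
    entry refl refl (right eq) = just (≈-sym eq)
    sum′ : Sum Γ (Γ′ ∖ x) (Δ ∖ x)
    sum′ u with u ≟ x
    ... | yes refl = ⊞-identityʳ (≡⇒≈ᵐ x∉Γ)
    ... | no _     = sum u
  -- x is shared, so the sum has it already and its insertion changes nothing.
  ...   | inj₁ (s , x∈Γ) = +, (∖-extension Γ′ (≡⇒≈ᵐ x∈))
      (go us (Γ′ ∖ x) Δ (∖-bound Γ′ bound) sum′)
      (keep (proj₁ (entry x∈Γ x∈ (sum x))) (proj₂ (entry x∈Γ x∈ (sum x))) (λ _ → ≈ᵐ-refl))
    where
    entry : ∀ {a b c} → a ≡ just s → b ≡ just t → a ⊞ b ↦ c → c ≈ᵐ just t × Un t
    entry refl refl (both _ eq un) = just (≈-sym eq) , Un-resp (≈-sym eq) un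
    drop : ∀ {a b c} → a ≡ just s → a ⊞ b ↦ c → a ≈ᵐ c
    drop refl (left eq) = just eq
    drop refl (both eq _ _) = just eq
    sum′ : Sum Γ (Γ′ ∖ x) Δ
    sum′ u with u ≟ x
    ... | yes refl = ⊞-identityʳ (drop x∈Γ (sum x))
    ... | no _     = sum u

lookup⁻ : ∀ {a t} → a ≈ᵐ just t → ∃[ s ] a ≡ just s × s ≈ t
lookup⁻ (just eq) = _ , refl , eq

≼-un : ∀ {a b s} → a ≼ b → b ≡ just s → (∀ {t} → a ≡ just t → Un t) → Un s
≼-un (same eq)  refl un = Un-resp eq (un refl)
≼-un (extra un) refl _  = un

≼-just : ∀ {a b t} → a ≼ b → a ≡ just t → ∃[ s ] b ≡ just s × t ≈ s
≼-just (same eq) refl = _ , refl , eq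

allUn-sum : (Γ Γ′ Δ : Env n) → Sum Γ Γ′ Δ → AllUn Γ → AllUn Γ′ → AllUn Δ
allUn-sum Γ Γ′ Δ sum un un′ u eq = go (sum u) eq (un u) (un′ u)
  where
  go : ∀ {a b c r} → a ⊞ b ↦ c → c ≡ just r →
       (∀ {t} → a ≡ just t → Un t) → (∀ {t} → b ≡ just t → Un t) → Un r
  go (left eq)     refl un _   = Un-resp eq (un refl)
  go (right eq)    refl _  un′ = Un-resp eq (un′ refl)
  go (both _ _ un) refl _  _   = un

allUn-▹⁻ : ∀ {Γ : Env n} {t ok} → AllUn (Γ ▹ t given ok) → AllUn Γ
allUn-▹⁻ {Γ = Γ} {ok = ok} un u eq = un (weakenName u) (trans (lookup-▹ Γ ok u) eq)

-- Expressions of unrestricted type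

admissible-disciplined : ∀ (u : Name n) {t} → Admissible u t → Disciplined t
admissible-disciplined (var _)        ok                  = disciplined-type ok
admissible-disciplined (chan _)       (_ , (_ , wf) , eq) =
  disciplined-resp (≈-sym eq) (disciplined-⟨⟩ (wellFormed⇒disciplined wf))
admissible-disciplined (endpoint _ _) (_ , wf)            = wellFormed⇒disciplined wf

range-disciplined : ∀ k α {t s} → Disciplined (●^ k (arrow α t s)) → Disciplined (●^ k s)
range-disciplined k α {t} {s} d = disciplined-●^ k (disciplined-⊑ (range α) (disciplined-●^⁻ k d))
  where
  range : ∀ α → s ⊑ arrow α t s
  range unrestricted = 1 ∷ [] , λ _ → refl
  range linear       = 1 ∷ [] , λ _ → refl

disciplined : ∀ {Γ : Env n} {e t} → Γ ⊢ e ∶ t → Disciplined t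
disciplined (≈-conv eq d)    = disciplined-resp eq (disciplined d)
disciplined (●I d)           = disciplined-● (disciplined d)
disciplined (const _ k)      = disciplined-constant k
disciplined (axiom {Δ = Δ} {u} Δ≐ _) with lookup⁻ (_≐_,_∶_.this Δ≐)
... | _ , eq , s≈t           = disciplined-resp s≈t (admissible-disciplined u (admissible Δ u eq))
disciplined (⇒I k ok _ _ _)  = disciplined-●^ k (disciplined-type ok)
disciplined (⊸I k ok _ _)    = disciplined-●^ k (disciplined-type ok)
disciplined (⇒E k d _ _)     = range-disciplined k unrestricted (disciplined d)
disciplined (⊸E k d _ _)     = range-disciplined k linear (disciplined d)
disciplined (⊗E _ _ _ _ d _) = disciplined d

-- An unrestricted result forces unrestricted premises: t → s with s unrestricted has
-- t unrestricted, t ⊸ s with s unrestricted is not a type, and a body with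
-- unrestricted environment binds unrestricted components only.
un⇒allUn : ∀ {Γ : Env n} {e t} → Γ ⊢ e ∶ t → Un t → AllUn Γ
un⇒allUn (≈-conv eq d) un = un⇒allUn d (Un-resp (≈-sym eq) un)
un⇒allUn (●I d)        un = un⇒allUn d (Un-●^⁻ 1 un)
un⇒allUn (const {Γ} unΓ _) un = unEnv⁻ Γ unΓ
un⇒allUn (axiom {Γ} {Δ} {u} Δ≐ unΓ) un v eq with v ≟ u
... | yes refl = entry this eq
  where
  open _≐_,_∶_ Δ≐
  entry : ∀ {a s} → a ≈ᵐ just _ → a ≡ just s → Un s
  entry (just s≈t) refl = Un-resp (≈-sym s≈t) un
... | no v≢u with lookup⁻ (≈ᵐ-sym (Eq.subst (_≈ᵐ _) eq (rest v v≢u)))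
  where open _≐_,_∶_ Δ≐
...   | _ , Γv , t≈s = Un-resp t≈s (unEnv⁻ Γ unΓ v Γv)
un⇒allUn (⇒I _ {Γ} _ _ _ unΓ) un = unEnv⁻ Γ unΓ
un⇒allUn (⊸I k _ _ _)     un = contradiction (Lin-●^ k (lin-⊸ ≈-refl)) un
un⇒allUn (⇒E k {Γ} {Γ₁} {Γ₂} d d′ sum)  un =
  allUn-sum Γ₁ Γ₂ Γ (+↦⇒Sum sum) (un⇒allUn d (Un-●^ k Un-⇒)) (un⇒allUn d′ (Un-●^ k unDom))
  where unDom = fun-un (disciplined-●^⁻ k (disciplined d)) ([] , λ _ → refl) (Un-●^⁻ k un)
un⇒allUn (⊸E k d d′ sum)  un =
  contradiction (Lin-●^ k (lolli-lin (disciplined-●^⁻ k (disciplined d)) ([] , λ _ → refl))) un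
un⇒allUn (⊗E k {Γ} {Γ₁} {Γ₂} d ok₁ ok₂ d′ sum) un =
  allUn-sum Γ₁ Γ₂ Γ (+↦⇒Sum sum)
    (un⇒allUn d (Un-●^ k (Un-⊗ (Un-●^⁻ k (unBody (var (suc zero)) refl)) (Un-●^⁻ k (unBody (var zero) refl)))))
    (allUn-▹⁻ {ok = ok₁} (allUn-▹⁻ {ok = ok₂} unBody))
  where unBody = un⇒allUn d′ un

-- Delayed forms of the typing rules

delay : ∀ j {Γ : Env n} {e t} → Γ ⊢ e ∶ t → Γ ⊢ e ∶ ●^ j t
delay zero    d = d
delay (suc j) d = ●I (delay j d)

-- The rules with their types given up to equality: adding a delay j to a rule of
-- level k produces ●^ j (●^ k t) where the rule asks for ●^ (j + k) t.
abs-⇒ : ∀ k {Γ : Env n} {e t s T S R} → T ≡ ●^ k t → S ≡ ●^ k s → R ≡ ●^ k (t ⇒ s) →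
  IsType (t ⇒ s) → (ok : IsType T) → Γ ▹ T given ok ⊢ e ∶ S → UnEnv Γ → Γ ⊢ lam e ∶ R
abs-⇒ k refl refl refl = ⇒I k

abs-⊸ : ∀ k {Γ : Env n} {e t s T S R} → T ≡ ●^ k t → S ≡ ●^ k s → R ≡ ●^ k (t ⊸ s) →
  IsType (t ⊸ s) → (ok : IsType T) → Γ ▹ T given ok ⊢ e ∶ S → Γ ⊢ lam e ∶ R
abs-⊸ k refl refl refl = ⊸I k

app : ∀ k α {Γ Γ₁ Γ₂ : Env n} {e f t s T S R} →
  R ≈ ●^ k (arrow α t s) → T ≈ ●^ k t → ●^ k s ≈ S →
  Γ₁ ⊢ e ∶ R → Γ₂ ⊢ f ∶ T → Sum Γ₁ Γ₂ Γ → Γ ⊢ e · f ∶ S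
app k unrestricted r t s d d′ sum =
  ≈-conv s (⇒E k (≈-conv r d) (≈-conv t d′) (Sum⇒+↦ sum))
app k linear       r t s d d′ sum =
  ≈-conv s (⊸E k (≈-conv r d) (≈-conv t d′) (Sum⇒+↦ sum))

elim-⊗ : ∀ k {Γ Γ₁ Γ₂ : Env n} {e f t₁ t₂ s T₁ T₂ S R} →
  R ≡ ●^ k (t₁ ⊗ t₂) → T₁ ≡ ●^ k t₁ → T₂ ≡ ●^ k t₂ → S ≡ ●^ k s →
  Γ₁ ⊢ e ∶ R → (ok₁ : IsType T₁) (ok₂ : IsType T₂) →
  Γ₂ ▹ T₁ given ok₁ ▹ T₂ given ok₂ ⊢ f ∶ S → Sum Γ₁ Γ₂ Γ → Γ ⊢ split e f ∶ S
elim-⊗ k refl refl refl refl d ok₁ ok₂ d′ sum = ⊗E k d ok₁ ok₂ d′ (Sum⇒+↦ sum)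

-- The substitution lemma

-- Whether a name with the given owner may be used by the image of u.
visible : Maybe (Name m) → Name m → Bool
visible nothing  u = true
visible (just v) u = does (v ≟ u)

visible-self : ∀ (u : Name m) a → mask (visible (just u) u) a ≡ a
visible-self u a with u ≟ u
... | yes _  = refl
... | no u≢u = contradiction refl u≢u

invisible : ∀ {u v : Name m} a → v ≢ u → mask (visible (just v) u) a ≡ nothing
invisible {u = u} {v} a v≢u with v ≟ u
... | yes v≡u = contradiction v≡u v≢u
... | no _    = refl

visible-weaken : ∀ o (u : Name m) → visible (Maybe.map weakenName o) (weakenName u) ≡ visible o u
visible-weaken nothing  u = refl
visible-weaken (just v) u with v ≟ u | weakenName v ≟ weakenName u
... | yes _    | yes _  = refl
... | no _     | no _   = refl
... | yes refl | no ne  = contradiction refl ne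
... | no v≢u   | yes eq = contradiction (weakenName-injective eq) v≢u

Judgement : Set₁
Judgement = ∀ {n} → Env n → Expr n → Tree → Set

-- What the traversal requires of the judgement V that types the images.
record Kit (V : Judgement) : Set₁ where
  field
    sound    : ∀ {n} {Δ : Env n} {e t} → V Δ e t → Δ ⊢ e ∶ t
    conv     : ∀ {n} {Δ : Env n} {e t s} → t ≈ s → V Δ e t → V Δ e s
    weaken   : ∀ {n} {Δ Δ′ : Env n} {e t} → Δ ≼ᴱ Δ′ → V Δ e t → V Δ′ e t
    shift    : ∀ {n} {Δ : Env n} {Δ′ : Env (suc n)} {e t} →
               lookup Δ′ (var zero) ≡ nothing →
               (∀ u → lookup Δ′ (weakenName u) ≡ lookup Δ u) →
               V Δ e t → V Δ′ (rename suc e) t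
    sole-name : ∀ {n} {Δ : Env n} {u t} → lookup Δ u ≡ just t →
                (∀ v {s} → v ≢ u → lookup Δ v ≡ just s → Un s) → V Δ (name u) t
    allUn    : ∀ {n} {Δ : Env n} {e t} → V Δ e t → Un t → AllUn Δ

-- Δ provides for the images under σ of all names in Γ, each typed j bullets later.
-- Channels and endpoints are included, as images of themselves, since they are
-- resources as well.  A name without owner is shared by all images.
record Substitution (V : Judgement) (j : ℕ) (Γ : Env m) (σ : Fin m → Expr n) (Δ : Env n) : Set where
  field
    owner  : Name n → Maybe (Name m)
    owned  : ∀ w {u t} → owner w ≡ just u → lookup Δ w ≡ just t → ∃[ s ] lookup Γ u ≡ just s
    shared : ∀ w {t} → owner w ≡ nothing → lookup Δ w ≡ just t → Un t

  part : Name m → Env n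
  part u = restrict (λ w → visible (owner w) u) Δ

  field
    image  : ∀ u {t} → lookup Γ u ≡ just t → V (part u) (subst σ (name u)) (●^ j t)

-- Whether a name with the given owner goes to the summand Γ.
claims : Env m → Maybe (Name m) → Bool
claims Γ nothing  = true
claims Γ (just u) = is-just (lookup Γ u)

liftOwner : (Name n → Maybe (Name m)) → Name (suc n) → Maybe (Name (suc m))
liftOwner o (var zero)     = just (var zero)
liftOwner o (var (suc x))  = Maybe.map weakenName (o (var x))
liftOwner o (chan a)       = Maybe.map weakenName (o (chan a))
liftOwner o (endpoint a p) = Maybe.map weakenName (o (endpoint a p))

liftOwner-old : ∀ (o : Name n → Maybe (Name m)) w →
  liftOwner o (weakenName w) ≡ Maybe.map weakenName (o w)
liftOwner-old o (var x)        = refl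
liftOwner-old o (chan a)       = refl
liftOwner-old o (endpoint a p) = refl

liftₛ-old : ∀ (σ : Fin m → Expr n) u →
  subst (liftₛ σ) (name (weakenName u)) ≡ rename suc (subst σ (name u))
liftₛ-old σ (var x)        = refl
liftₛ-old σ (chan a)       = refl
liftₛ-old σ (endpoint a p) = refl

map-nothing⁻ : {A B : Set} {f : A → B} {a : Maybe A} → Maybe.map f a ≡ nothing → a ≡ nothing
map-nothing⁻ {a = nothing} refl = refl

map-just⁻ : {A B : Set} (f : A → B) {a : Maybe A} {b : B} →
  Maybe.map f a ≡ just b → ∃[ x ] a ≡ just x × b ≡ f x
map-just⁻ f {just x} refl = x , refl , refl

module _ {V : Judgement} (K : Kit V) {j : ℕ} where
  open Kit K
  open Substitution

  in-part : ∀ {Γ : Env m} {σ} {Δ : Env n} (S : Substitution V j Γ σ Δ) w {u} →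
    owner S w ≡ just u → lookup (part S u) w ≡ lookup Δ w
  in-part {Δ = Δ} S w {u} eq =
    trans (cong (λ o → mask (visible o u) (lookup Δ w)) eq) (visible-self u (lookup Δ w))

  -- The image of an unrestricted owner has an unrestricted type, hence so has every name
  -- in its environment.
  shared-un : ∀ {Γ : Env m} {σ} {Δ : Env n} (S : Substitution V j Γ σ Δ) w {u t s} →
    owner S w ≡ just u → lookup Γ u ≡ just s → Un s → lookup Δ w ≡ just t → Un t
  shared-un S w {u} o Γu un Δw =
    allUn (image S u Γu) (Un-●^ j un) w (trans (in-part S w o) Δw)

  substitution-allUn : ∀ {Γ : Env m} {σ} {Δ : Env n} →
    Substitution V j Γ σ Δ → AllUn Γ → AllUn Δ
  substitution-allUn S un w Δw with owner S w in o
  ... | nothing = shared S w o Δw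
  ... | just u  = let s , Γu = owned S w o Δw in shared-un S w o Γu (un u Γu) Δw

  -- Where the expression is the name u, the names owned by others are unused but unrestricted.
  part-≼ : ∀ {Γ : Env m} {σ} {Δ : Env n} (S : Substitution V j Γ σ Δ) u →
    (∀ v {s} → v ≢ u → lookup Γ v ≡ just s → Un s) → part S u ≼ᴱ Δ
  part-≼ {Δ = Δ} S u un w with owner S w in o
  ... | nothing = ≼-refl
  ... | just v with v ≟ u
  ...   | yes _ = ≼-refl
  ...   | no v≢u with lookup Δ w in Δw
  ...     | nothing = none
  ...     | just _  = let s , Γv = owned S w o Δw in extra (shared-un S w o Γv (un v v≢u Γv) Δw)

  -- Only the names whose owners are in Γ′ are kept, together with the shared ones.
  confine : ∀ {Γ Γ′ : Env m} {σ} {Δ : Env n} (S : Substitution V j Γ σ Δ) →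
    (∀ u {t} → lookup Γ′ u ≡ just t → ∃[ s ] lookup Γ u ≡ just s × s ≈ t) →
    Substitution V j Γ′ σ (restrict (λ w → claims Γ′ (owner S w)) Δ)
  confine {Γ′ = Γ′} {Δ = Δ} S sub .owner = owner S
  confine {Γ′ = Γ′} {Δ = Δ} S sub .owned w {u} o eq
    rewrite o with lookup Γ′ u
  ... | just _ = _ , refl
  confine {Γ′ = Γ′} {Δ = Δ} S sub .shared w o eq =
    shared S w o (mask-just (claims Γ′ (owner S w)) eq)
  confine {Γ′ = Γ′} {Δ = Δ} S sub .image u Γ′u with sub u Γ′u
  ... | s , Γu , s≈t = weaken inclusion (conv (●^-cong j s≈t) (image S u Γu))
    where
    inclusion : ∀ w → mask (visible (owner S w) u) (lookup Δ w) ≼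
      mask (visible (owner S w) u) (mask (claims Γ′ (owner S w)) (lookup Δ w))
    inclusion w with owner S w
    ... | nothing = ≼-refl
    ... | just v with v ≟ u
    ...   | no _     = none
    ...   | yes refl rewrite Γ′u = ≼-refl

  -- A name goes to the summands that contain its owner.  If both do, the owner is
  -- unrestricted by the definition of sums, and so is the name.
  divide : ∀ {Γ Γ₁ Γ₂ : Env m} {σ} {Δ : Env n} → Substitution V j Γ σ Δ → Sum Γ₁ Γ₂ Γ →
    ∃[ Δ₁ ] ∃[ Δ₂ ] Substitution V j Γ₁ σ Δ₁ × Substitution V j Γ₂ σ Δ₂ × Sum Δ₁ Δ₂ Δ
  divide {Γ = Γ} {Γ₁} {Γ₂} {Δ = Δ} S sum =
    _ , _ , confine S (λ u → summand (sum u)) , confine S (λ u → summand (⊞-comm (sum u))) , sums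
    where
    summand : ∀ {a b c t} → a ⊞ b ↦ c → a ≡ just t → ∃[ s ] c ≡ just s × s ≈ t
    summand (left eq)     refl = _ , refl , ≈-sym eq
    summand (both eq _ _) refl = _ , refl , ≈-sym eq

    divided : ∀ {a b s t} → a ⊞ b ↦ just s → (Un s → Un t) →
      mask (is-just a) (just t) ⊞ mask (is-just b) (just t) ↦ just t
    divided (left _)      un = left ≈-refl
    divided (right _)     un = right ≈-refl
    divided (both _ _ us) un = both ≈-refl ≈-refl (un us)

    sums : ∀ w → mask (claims Γ₁ (owner S w)) (lookup Δ w) ⊞
                 mask (claims Γ₂ (owner S w)) (lookup Δ w) ↦ lookup Δ w
    sums w with lookup Δ w in Δw
    ... | nothing rewrite mask-nothing (claims Γ₁ (owner S w))
                        | mask-nothing (claims Γ₂ (owner S w)) = none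
    ... | just t with owner S w in o
    ...   | nothing = both ≈-refl ≈-refl (shared S w o Δw)
    ...   | just u with owned S w o Δw
    ...     | s , Γu = divided (Eq.subst (_ ⊞ _ ↦_) Γu (sum u)) (λ un → shared-un S w o Γu un Δw)

  -- The bound variable owns itself.
  lift : ∀ {Γ : Env m} {σ} {Δ : Env n} {t ok} ok′ → Substitution V j Γ σ Δ →
    Substitution V j (Γ ▹ t given ok) (liftₛ σ) (Δ ▹ ●^ j t given ok′)
  lift ok′ S .owner = liftOwner (owner S)
  lift {Γ = Γ} {Δ = Δ} {ok = ok} ok′ S .owned w o eq with nameView w
  lift ok′ S .owned _ refl eq | new = _ , refl
  lift {Γ = Γ} {Δ = Δ} {ok = ok} ok′ S .owned _ o eq | old w
    with map-just⁻ weakenName (trans (sym (liftOwner-old (owner S) w)) o)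
  ... | u , o′ , refl with owned S w o′ (trans (sym (lookup-▹ Δ ok′ w)) eq)
  ...   | s , Γu = s , trans (lookup-▹ Γ ok u) Γu
  lift ok′ S .shared w o eq with nameView w
  lift ok′ S .shared _ () eq | new
  lift {Δ = Δ} ok′ S .shared _ o eq | old w =
    shared S w (map-nothing⁻ (trans (sym (liftOwner-old (owner S) w)) o))
      (trans (sym (lookup-▹ Δ ok′ w)) eq)
  lift ok′ S .image u eq with nameView u
  lift {Δ = Δ} ok′ S .image _ refl | new = sole-name refl others
    where
    others : ∀ v {s} → v ≢ var zero →
      mask (visible (liftOwner (owner S) v) (var zero)) (lookup (Δ ▹ _ given ok′) v) ≡ just s → Un s
    others v v≢0 eq with nameView v
    ... | new = contradiction refl v≢0
    ... | old w rewrite liftOwner-old (owner S) w | lookup-▹ Δ ok′ w with owner S w in o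
    ...   | nothing = shared S w o eq
    ...   | just u  with trans (sym eq) (invisible {u = var zero} (lookup Δ w) (weakenName≢zero u))
    ...     | ()
  lift {Γ = Γ} {σ} {Δ} {ok = ok} ok′ S .image _ eq | old u =
    Eq.subst (λ e → V _ e _) (sym (liftₛ-old σ u))
      (shift (invisible _ (λ eq → weakenName≢zero u (sym eq))) same-part
        (image S u (trans (sym (lookup-▹ Γ ok u)) eq)))
    where
    same-part : ∀ w → mask (visible (liftOwner (owner S) (weakenName w)) (weakenName u))
      (lookup (Δ ▹ _ given ok′) (weakenName w)) ≡ lookup (part S u) w
    same-part w = cong₂ mask
      (trans (cong (λ o → visible o (weakenName u)) (liftOwner-old (owner S) w))
             (visible-weaken (owner S w) u))
      (lookup-▹ Δ ok′ w)

  substitute : ∀ {Γ : Env m} {σ} {Δ : Env n} {e t} →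
    Γ ⊢ e ∶ t → Substitution V j Γ σ Δ → Δ ⊢ subst σ e ∶ ●^ j t
  substitute (≈-conv eq d) S = ≈-conv (●^-cong j eq) (substitute d S)
  substitute (●I {t = t} d) S = ≈-conv (≡⇒≈ (●-●^ j t)) (●I (substitute d S))
    where
    ●-●^ : ∀ k t → ● ●^ k t ≡ ●^ k (● t)
    ●-●^ zero    t = refl
    ●-●^ (suc k) t = cong ●_ (●-●^ k t)
  substitute {Γ = Γ} {Δ = Δ} (const un k) S =
    delay j (const (unEnv⁺ Δ (substitution-allUn S (unEnv⁻ Γ un))) k)
  substitute (axiom {Γ} {Δ} {u} Δ≐ un) S with lookup⁻ (_≐_,_∶_.this Δ≐)
  ... | s , Δu , s≈t =
    ≈-conv (●^-cong j s≈t) (sound (weaken (part-≼ S u others) (image S u Δu)))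
    where
    others : ∀ v {s} → v ≢ u → lookup Δ v ≡ just s → Un s
    others v v≢u Δv with lookup⁻ (≈ᵐ-sym (Eq.subst (_≈ᵐ _) Δv (_≐_,_∶_.rest Δ≐ v v≢u)))
    ... | _ , Γv , t≈s = Un-resp t≈s (unEnv⁻ Γ un v Γv)
  substitute {Γ = Γ} {Δ = Δ} (⇒I k {t = t} {s} okᶠ ok d un) S =
    abs-⇒ (j + k) (sym (●^-+ j k t)) (sym (●^-+ j k s)) (sym (●^-+ j k (t ⇒ s))) okᶠ
      (isType-●^ j ok) (substitute d (lift (isType-●^ j ok) S))
      (unEnv⁺ Δ (substitution-allUn S (unEnv⁻ Γ un)))
  substitute (⊸I k {t = t} {s} okᶠ ok d) S =
    abs-⊸ (j + k) (sym (●^-+ j k t)) (sym (●^-+ j k s)) (sym (●^-+ j k (t ⊸ s))) okᶠ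
      (isType-●^ j ok) (substitute d (lift (isType-●^ j ok) S))
  substitute (⇒E k {t = t} {s} d d′ sum) S with divide S (+↦⇒Sum sum)
  ... | _ , _ , S₁ , S₂ , sum′ =
    app (j + k) unrestricted (≡⇒≈ (sym (●^-+ j k (t ⇒ s)))) (≡⇒≈ (sym (●^-+ j k t)))
      (≡⇒≈ (●^-+ j k s)) (substitute d S₁) (substitute d′ S₂) sum′
  substitute (⊸E k {t = t} {s} d d′ sum) S with divide S (+↦⇒Sum sum)
  ... | _ , _ , S₁ , S₂ , sum′ =
    app (j + k) linear (≡⇒≈ (sym (●^-+ j k (t ⊸ s)))) (≡⇒≈ (sym (●^-+ j k t)))
      (≡⇒≈ (●^-+ j k s)) (substitute d S₁) (substitute d′ S₂) sum′
  substitute (⊗E k {t₁ = t₁} {t₂} {s} d ok₁ ok₂ d′ sum) S with divide S (+↦⇒Sum sum)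
  ... | _ , _ , S₁ , S₂ , sum′ =
    elim-⊗ (j + k) (sym (●^-+ j k (t₁ ⊗ t₂))) (sym (●^-+ j k t₁)) (sym (●^-+ j k t₂))
      (sym (●^-+ j k s)) (substitute d S₁) (isType-●^ j ok₁) (isType-●^ j ok₂)
      (substitute d′ (lift (isType-●^ j ok₂) (lift (isType-●^ j ok₁) S₂))) sum′

-- Renaming and weakening

record IsName {n} (Δ : Env n) (e : Expr n) (t : Tree) : Set where
  field
    {itself} : Name n
    {found}  : Tree
    is-name  : e ≡ name itself
    present  : lookup Δ itself ≡ just found
    found≈   : found ≈ t
    others   : ∀ v {s} → v ≢ itself → lookup Δ v ≡ just s → Un s

names : Kit IsName
names = record
  { sound     = sound
  ; conv      = λ eq N → record { IsName N ; found≈ = ≈-trans (IsName.found≈ N) eq }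
  ; weaken    = weaken
  ; shift     = shift
  ; sole-name = λ eq un → record { is-name = refl ; present = eq ; found≈ = ≈-refl ; others = un }
  ; allUn     = allUn
  }
  where
  open IsName

  sound : ∀ {n} {Δ : Env n} {e t} → IsName Δ e t → Δ ⊢ e ∶ t
  sound {Δ = Δ} record { itself = u ; is-name = refl ; present = eq ; found≈ = s≈t ; others = un } =
    ≈-conv s≈t (axiom (∖-extension Δ (≡⇒≈ᵐ eq)) (unEnv⁺ (Δ ∖ u) un-rest))
    where
    un-rest : AllUn (Δ ∖ u)
    un-rest v eq′ with v ≟ u
    ... | no v≢u = un v v≢u eq′

  weaken : ∀ {n} {Δ Δ′ : Env n} {e t} → Δ ≼ᴱ Δ′ → IsName Δ e t → IsName Δ′ e t
  weaken le N with ≼-just (le (itself N)) (present N)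
  ... | s , eq , t≈s = record
    { is-name = is-name N
    ; present = eq
    ; found≈   = ≈-trans (≈-sym t≈s) (found≈ N)
    ; others  = λ v v≢u Δ′v → ≼-un (le v) Δ′v (others N v v≢u)
    }

  shift : ∀ {n} {Δ : Env n} {Δ′ : Env (suc n)} {e t} →
    lookup Δ′ (var zero) ≡ nothing →
    (∀ u → lookup Δ′ (weakenName u) ≡ lookup Δ u) →
    IsName Δ e t → IsName Δ′ (rename suc e) t
  shift {Δ′ = Δ′} new∉ agree N = record
    { is-name = cong (rename suc) (is-name N)
    ; present = trans (agree (itself N)) (present N)
    ; found≈   = found≈ N
    ; others  = un
    }
    where
    un : ∀ v {s} → v ≢ weakenName (itself N) → lookup Δ′ v ≡ just s → Un s
    un v v≢u eq with nameView v
    ... | new with trans (sym new∉) eq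
    ...   | ()
    un _ v≢u eq | old w =
      others N w (λ { refl → v≢u refl }) (trans (sym (agree w)) eq)

  allUn : ∀ {n} {Δ : Env n} {e t} → IsName Δ e t → Un t → AllUn Δ
  allUn N un v eq with v ≟ itself N
  ... | no v≢u = others N v v≢u eq
  ... | yes refl with trans (sym (present N)) eq
  ...   | refl = Un-resp (≈-sym (found≈ N)) un

Renames : (Fin m → Fin n) → (Fin m → Expr n) → Set
Renames ρ σ = ∀ x → σ x ≡ name (var (ρ x))

liftₛ-renames : ∀ {ρ : Fin m → Fin n} {σ} → Renames ρ σ → Renames (liftᵣ ρ) (liftₛ σ)
liftₛ-renames eq zero    = refl
liftₛ-renames eq (suc x) = cong (rename suc) (eq x)

subst≡rename : ∀ {ρ : Fin m → Fin n} {σ} → Renames ρ σ → ∀ e → subst σ e ≡ rename ρ e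
subst≡rename eq (con k)               = refl
subst≡rename eq (name (var x))        = eq x
subst≡rename eq (name (chan a))       = refl
subst≡rename eq (name (endpoint a p)) = refl
subst≡rename eq (lam e)     = cong lam (subst≡rename (liftₛ-renames eq) e)
subst≡rename eq (e · f)     = cong₂ _·_ (subst≡rename eq e) (subst≡rename eq f)
subst≡rename eq (split e f) =
  cong₂ split (subst≡rename eq e) (subst≡rename (liftₛ-renames (liftₛ-renames eq)) f)

liftₛ-id : {σ : Fin n → Expr n} → (∀ x → σ x ≡ idₛ x) → ∀ x → liftₛ σ x ≡ idₛ x
liftₛ-id eq zero    = refl
liftₛ-id eq (suc x) = cong (rename suc) (eq x)

subst-id : {σ : Fin n → Expr n} → (∀ x → σ x ≡ idₛ x) → ∀ e → subst σ e ≡ e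
subst-id eq (con k)               = refl
subst-id eq (name (var x))        = eq x
subst-id eq (name (chan a))       = refl
subst-id eq (name (endpoint a p)) = refl
subst-id eq (lam e)     = cong lam (subst-id (liftₛ-id eq) e)
subst-id eq (e · f)     = cong₂ _·_ (subst-id eq e) (subst-id eq f)
subst-id eq (split e f) = cong₂ split (subst-id eq e) (subst-id (liftₛ-id (liftₛ-id eq)) f)

-- The identity substitution, in which the additional names are shared.
weakening : ∀ {Γ Δ : Env n} {e t} → Γ ≼ᴱ Δ → Γ ⊢ e ∶ t → Δ ⊢ e ∶ t
weakening {n} {Γ} {Δ} {e} le d =
  Eq.subst (λ e → Δ ⊢ e ∶ _) (subst-id (λ _ → refl) e) (substitute names d inclusion)
  where
  own : Maybe Tree → Name n → Maybe (Name n)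
  own (just _) u = just u
  own nothing  u = nothing

  own-present : ∀ a {w u} → own a w ≡ just u → ∃[ s ] a ≡ just s × w ≡ u
  own-present (just s) refl = s , refl , refl

  own-extra : ∀ {a b w t} → a ≼ b → own a w ≡ nothing → b ≡ just t → Un t
  own-extra (extra un) refl refl = un

  own-other : ∀ {a b u v s} → a ≼ b → v ≢ u → mask (visible (own a v) u) b ≡ just s → Un s
  own-other (extra un) v≢u refl = un
  own-other {u = u} {v} (same {s = r} _) v≢u eq with trans (sym eq) (invisible (just r) v≢u)
  ... | ()

  inclusion : Substitution IsName 0 Γ idₛ Δ
  inclusion .Substitution.owner w = own (lookup Γ w) w
  inclusion .Substitution.owned w o _ with own-present (lookup Γ w) o
  ... | s , Γw , refl = s , Γw
  inclusion .Substitution.shared w = own-extra (le w)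
  inclusion .Substitution.image u Γu with ≼-just (le u) Γu
  ... | s , Δu , t≈s = record
    { is-name = subst-id (λ _ → refl) (name u)
    ; present = trans (cong (λ a → mask (visible (own a u) u) (lookup Δ u)) Γu)
                      (trans (visible-self u (lookup Δ u)) Δu)
    ; found≈   = ≈-sym t≈s
    ; others  = λ v v≢u → own-other (le v) v≢u
    }

-- The new variable has no owner.  Being absent from Δ, it meets the condition on
-- shared names vacuously.
shifting : ∀ {Γ : Env n} {Δ : Env (suc n)} {e t} →
  lookup Δ (var zero) ≡ nothing →
  (∀ u → lookup Δ (weakenName u) ≡ lookup Γ u) →
  Γ ⊢ e ∶ t → Δ ⊢ rename suc e ∶ t
shifting {n} {Γ} {Δ} {e} new∉ agree d =
  Eq.subst (λ e → Δ ⊢ e ∶ _) (subst≡rename (λ _ → refl) e) (substitute names d shifted)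
  where
  own : ∀ {w : Name (suc n)} → NameView w → Maybe (Name n)
  own new     = nothing
  own (old u) = just u

  nameView-old : ∀ u → own (nameView (weakenName u)) ≡ just u
  nameView-old (var _)        = refl
  nameView-old (chan _)       = refl
  nameView-old (endpoint _ _) = refl

  shifted : Substitution IsName 0 Γ (λ x → name (var (suc x))) Δ
  shifted .Substitution.owner w = own (nameView w)
  shifted .Substitution.owned w o eq with nameView w
  shifted .Substitution.owned _ refl eq | old u = _ , trans (sym (agree u)) eq
  shifted .Substitution.shared w o eq with nameView w
  shifted .Substitution.shared _ o eq | new with trans (sym new∉) eq
  ... | ()
  shifted .Substitution.image u Γu = record
    { is-name = subst≡rename (λ _ → refl) (name u)
    ; present = trans (cong (λ o → mask (visible o u) (lookup Δ (weakenName u))) (nameView-old u))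
                      (trans (visible-self u _) (trans (agree u) Γu))
    ; found≈   = ≈-refl
    ; others  = un
    }
    where
    un : ∀ v {s} → v ≢ weakenName u → mask (visible (own (nameView v)) u) (lookup Δ v) ≡ just s → Un s
    un v v≢u eq with nameView v
    ... | new with trans (sym new∉) eq
    ...   | ()
    un _ v≢u eq | old w with trans (sym eq) (invisible {u = u} {w} (lookup Δ (weakenName w)) (λ w≡u → v≢u (cong weakenName w≡u)))
    ...   | ()
-- Substitution of expressions

expressions : Kit _⊢_∶_
expressions = record
  { sound     = λ d → d
  ; conv      = ≈-conv
  ; weaken    = weakening
  ; shift     = shifting
  ; sole-name = λ eq un → Kit.sound names (Kit.sole-name names eq un)
  ; allUn     = un⇒allUn
  }

-- Every name owns itself, and is typed by the axiom followed by j delays.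
identity : ∀ j (Γ : Env n) → Substitution _⊢_∶_ j Γ idₛ Γ
identity j Γ .Substitution.owner w = just w
identity j Γ .Substitution.owned w refl eq = _ , eq
identity j Γ .Substitution.shared w () eq
identity j Γ .Substitution.image u Γu =
  Eq.subst (λ e → restrict (λ w → visible (just w) u) Γ ⊢ e ∶ _)
    (sym (subst-id (λ _ → refl) (name u)))
    (delay j (Kit.sole-name expressions (trans (visible-self u _) Γu)
      (λ v v≢u eq → contradiction (trans (sym eq) (invisible (lookup Γ v) v≢u)) λ ())))

-- The names contributed only by the environment of the new image f belong to the new
-- variable, and those contributed by both are shared.  The sum itself tells the
-- cases apart, so linearity need not be decided.
extendOwner : ∀ {a b c} → a ⊞ b ↦ c → Maybe (Name m) → Maybe (Name (suc m))
extendOwner none         o = nothing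
extendOwner (left _)     o = Maybe.map weakenName o
extendOwner (right _)    o = just (var zero)
extendOwner (both _ _ _) o = nothing

-- Adding one image at a time serves both kinds of redex that substitute: from the
-- identity, an abstraction takes one step and a split two.
extend : ∀ {j} {Γ : Env m} {σ} {Δ₁ Δ₂ Δ : Env n} {f t ok} →
  Substitution _⊢_∶_ j Γ σ Δ₁ → Δ₂ ⊢ f ∶ ●^ j t → Sum Δ₁ Δ₂ Δ →
  Substitution _⊢_∶_ j (Γ ▹ t given ok) (σ ∷ₛ f) Δ
extend {m} {n} {j} {Γ} {σ} {Δ₁} {Δ₂} {Δ} {f} {t} {ok} S d sum = extended
  where
  open Substitution

  owned′ : ∀ {a b c o u} (q : a ⊞ b ↦ c) → extendOwner q o ≡ just u →
    (∀ {v r} → o ≡ just v → a ≡ just r → ∃[ s ] lookup Γ v ≡ just s) →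
    ∃[ s ] lookup (Γ ▹ t given ok) u ≡ just s
  owned′ (right _) refl _   = _ , refl
  owned′ (left _)  eq   own with map-just⁻ weakenName eq
  ... | v , o , refl with own o refl
  ...   | s , Γv = s , trans (lookup-▹ Γ ok v) Γv

  shared′ : ∀ {a b c o s} (q : a ⊞ b ↦ c) → extendOwner {m} q o ≡ nothing → c ≡ just s →
    (∀ {r} → o ≡ nothing → a ≡ just r → Un r) → Un s
  shared′ (left eq)     o refl un = Un-resp eq (un (map-nothing⁻ o) refl)
  shared′ (both _ _ us) o refl un = us

  new-part : ∀ {a b c} (q : a ⊞ b ↦ c) o → (∀ {r} → o ≡ nothing → a ≡ just r → Un r) →
    b ≼ mask (visible (extendOwner {m} q o) (var zero)) c
  new-part none           o        un = none
  new-part (left eq)      nothing  un = extra (Un-resp eq (un refl refl))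
  new-part (left eq)      (just v) un =
    ≼-reflexive (sym (invisible {u = var zero} _ (weakenName≢zero v)))
  new-part (right eq)     o        un = same eq
  new-part (both _ eq _)  o        un = same eq

  -- What f shares with the first summand is visible to every image, since it is
  -- unrestricted.
  old-part : ∀ {a b c} (q : a ⊞ b ↦ c) o u →
    mask (visible o u) a ≼ mask (visible (extendOwner {m} q o) (weakenName u)) c
  old-part none o u rewrite mask-nothing (visible o u) = none
  old-part (left eq) o u rewrite visible-weaken o u with visible o u
  ... | true  = same eq
  ... | false = none
  old-part (right {s} {r} eq) o u
    rewrite mask-nothing (visible o u)
          | invisible {u = weakenName u} {var zero} (just r) (λ e → weakenName≢zero u (sym e)) = none
  old-part (both eq _ un) o u with visible o u
  ... | true  = same eq
  ... | false = extra un

  ∷ₛ-old : ∀ u → subst (σ ∷ₛ f) (name (weakenName u)) ≡ subst σ (name u)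
  ∷ₛ-old (var _)        = refl
  ∷ₛ-old (chan _)       = refl
  ∷ₛ-old (endpoint _ _) = refl

  extended : Substitution _⊢_∶_ j (Γ ▹ t given ok) (σ ∷ₛ f) Δ
  extended .owner w = extendOwner (sum w) (owner S w)
  extended .owned w o _ = owned′ (sum w) o (owned S w)
  extended .shared w o eq = shared′ (sum w) o eq (shared S w)
  extended .image u eq with nameView u
  extended .image _ refl | new = weakening (λ w → new-part (sum w) (owner S w) (shared S w)) d
  extended .image _ eq | old u =
    Eq.subst (λ e → _ ⊢ e ∶ _) (sym (∷ₛ-old u))
      (weakening (λ w → old-part (sum w) (owner S w) u)
        (image S u (trans (sym (lookup-▹ Γ ok u)) eq)))

-- The summand Γ₃₁ is Γ restricted to the domains of Γ₃ and Γ₁.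
sum-rotate : (Γ₁ Γ₂ Γ₃ Γ₁₂ Γ : Env n) → Sum Γ₁ Γ₂ Γ₁₂ → Sum Γ₁₂ Γ₃ Γ →
  ∃[ Γ₃₁ ] Sum Γ₃ Γ₁ Γ₃₁ × Sum Γ₃₁ Γ₂ Γ
sum-rotate Γ₁ Γ₂ Γ₃ Γ₁₂ Γ sum sum′ =
  restrict (λ u → is-just (lookup Γ₃ u) ∨ is-just (lookup Γ₁ u)) Γ ,
  (λ u → inner (sum u) (sum′ u)) , (λ u → outer (sum u) (sum′ u))
  where
  inner : ∀ {a b c d e} → a ⊞ b ↦ d → d ⊞ c ↦ e → c ⊞ a ↦ mask (is-just c ∨ is-just a) e
  inner none        none             = none
  inner none        (right eq)       = left eq
  inner (left p)    (left q)         = right (≈-trans p q)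
  inner (left p)    (both q r un)    = both r (≈-trans p q) un
  inner (right p)   (left q)         = none
  inner (right p)   (both q r un)    = left r
  inner (both p q _) (left r)        = right (≈-trans p r)
  inner (both p q _) (both r s un)   = both s (≈-trans p r) un

  outer : ∀ {a b c d e} → a ⊞ b ↦ d → d ⊞ c ↦ e → mask (is-just c ∨ is-just a) e ⊞ b ↦ e
  outer none        none             = none
  outer none        (right eq)       = left ≈-refl
  outer (left p)    (left q)         = left ≈-refl
  outer (left p)    (both q r un)    = left ≈-refl
  outer (right p)   (left q)         = right (≈-trans p q)
  outer (right p)   (both q r un)    = both ≈-refl (≈-trans p q) un
  outer (both p q un) (left r)       = both ≈-refl (≈-trans q r) (Un-resp r un)
  outer (both p q _) (both r s un)   = both ≈-refl (≈-trans q r) un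

-- Inversion of typing

-- The outermost uses of the delay rule and of conversion are collected in `delays` and
-- `result`; level is that of the elimination rule that they follow.
record Application {n} (Γ : Env n) (e f : Expr n) (r : Tree) : Set where
  field
    {Γ₁ Γ₂} : Env n
    {t s}   : Tree
    delays  : ℕ
    level   : ℕ
    kind    : Arrow
    function : Γ₁ ⊢ e ∶ ●^ level (arrow kind t s)
    argument : Γ₂ ⊢ f ∶ ●^ level t
    sum     : Sum Γ₁ Γ₂ Γ
    result  : ●^ (delays + level) s ≈ r

application⁻ : ∀ {Γ : Env n} {e f r} → Γ ⊢ e · f ∶ r → Application Γ e f r
application⁻ (≈-conv eq d)  = let A = application⁻ d in
  record { Application A ; result = ≈-trans (Application.result A) eq }
application⁻ (●I d)         = let A = application⁻ d in
  record { Application A ; delays = suc (Application.delays A) ; result = ●-cong (Application.result A) }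
application⁻ (⇒E k d d′ sum) = record
  { delays = 0 ; level = k ; kind = unrestricted
  ; function = d ; argument = d′ ; sum = +↦⇒Sum sum ; result = ≈-refl }
application⁻ (⊸E k d d′ sum) = record
  { delays = 0 ; level = k ; kind = linear
  ; function = d ; argument = d′ ; sum = +↦⇒Sum sum ; result = ≈-refl }

application⁺ : ∀ {Γ : Env n} {e f r} (A : Application Γ e f r) {e′ f′} → let open Application A in
  Γ₁ ⊢ e′ ∶ ●^ level (arrow kind t s) → Γ₂ ⊢ f′ ∶ ●^ level t → Γ ⊢ e′ · f′ ∶ r
application⁺ A d d′ =
  ≈-conv (≈-trans (≡⇒≈ (sym (●^-+ delays level s))) result)
    (delay delays (app level kind ≈-refl ≈-refl ≈-refl d d′ sum))
  where open Application A

record Splitting {n} (Γ : Env n) (e : Expr n) (f : Expr (suc (suc n))) (r : Tree) : Set where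
  field
    {Γ₁ Γ₂}  : Env n
    {t₁ t₂ s} : Tree
    delays   : ℕ
    level    : ℕ
    pairing  : Γ₁ ⊢ e ∶ ●^ level (t₁ ⊗ t₂)
    ok₁      : IsType (●^ level t₁)
    ok₂      : IsType (●^ level t₂)
    body     : Γ₂ ▹ ●^ level t₁ given ok₁ ▹ ●^ level t₂ given ok₂ ⊢ f ∶ ●^ level s
    sum      : Sum Γ₁ Γ₂ Γ
    result   : ●^ delays (●^ level s) ≈ r

splitting⁻ : ∀ {Γ : Env n} {e f r} → Γ ⊢ split e f ∶ r → Splitting Γ e f r
splitting⁻ (≈-conv eq d) = let S = splitting⁻ d in
  record { Splitting S ; result = ≈-trans (Splitting.result S) eq }
splitting⁻ (●I d)        = let S = splitting⁻ d in
  record { Splitting S ; delays = suc (Splitting.delays S) ; result = ●-cong (Splitting.result S) }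
splitting⁻ (⊗E k d ok₁ ok₂ d′ sum) = record
  { delays = 0 ; level = k ; pairing = d ; ok₁ = ok₁ ; ok₂ = ok₂ ; body = d′
  ; sum = +↦⇒Sum sum ; result = ≈-refl }

record Abstraction {n} (Γ : Env n) (e : Expr (suc n)) (r : Tree) : Set where
  field
    {t s}  : Tree
    delays : ℕ
    level  : ℕ
    kind   : Arrow
    ok     : IsType (●^ level t)
    body   : Γ ▹ ●^ level t given ok ⊢ e ∶ ●^ level s
    result : ●^ (delays + level) (arrow kind t s) ≈ r

abstraction⁻ : ∀ {Γ : Env n} {e r} → Γ ⊢ lam e ∶ r → Abstraction Γ e r
abstraction⁻ (≈-conv eq d) = let A = abstraction⁻ d in
  record { Abstraction A ; result = ≈-trans (Abstraction.result A) eq }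
abstraction⁻ (●I d)        = let A = abstraction⁻ d in
  record { Abstraction A ; delays = suc (Abstraction.delays A) ; result = ●-cong (Abstraction.result A) }
abstraction⁻ (⇒I k _ ok d _) = record
  { delays = 0 ; level = k ; kind = unrestricted ; ok = ok ; body = d ; result = ≈-refl }
abstraction⁻ (⊸I k _ ok d)   = record
  { delays = 0 ; level = k ; kind = linear ; ok = ok ; body = d ; result = ≈-refl }

constant⁻ : ∀ {Γ : Env n} {k t} → Γ ⊢ con k ∶ t →
  ∃[ j ] ∃[ s ] s ∈types k × ●^ j s ≈ t × UnEnv Γ
constant⁻ (≈-conv eq d) with constant⁻ d
... | j , s , k , eq′ , un = j , s , k , ≈-trans eq′ eq , un
constant⁻ (●I d) with constant⁻ d
... | j , s , k , eq′ , un = suc j , s , k , ●-cong eq′ , un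
constant⁻ (const un k) = 0 , _ , k , ≈-refl , un

constant-undelayed : ∀ {k t} → t ∈types k → Undelayed t
constant-undelayed unitᵏ         ()
constant-undelayed (returnᵏ _)   ()
constant-undelayed (openᵏ _)     ()
constant-undelayed (sendᵏ _ _)   ()
constant-undelayed (recvᵏ _ _)   ()
constant-undelayed (futureᵏ _ _) ()
constant-undelayed (pairˡ _ _ _) ()
constant-undelayed (pairᵘ _ _ _) ()
constant-undelayed (bindᵏ _ _)   ()

sum-≼ʳ : (Γ₁ Γ₂ Γ : Env n) → Sum Γ₁ Γ₂ Γ → AllUn Γ₁ → Γ₂ ≼ᴱ Γ
sum-≼ʳ Γ₁ Γ₂ Γ sum un u = go (sum u) (un u)
  where
  go : ∀ {a b c} → a ⊞ b ↦ c → (∀ {t} → a ≡ just t → Un t) → b ≼ c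
  go none          un = none
  go (left eq)     un = extra (Un-resp eq (un refl))
  go (right eq)    un = same eq
  go (both _ eq _) un = same eq

-- A constant is typed in an unrestricted environment, so its argument can be typed in
-- the environment of the whole application, and at the level of the result.
constant-application⁻ : ∀ {Γ : Env n} {k e r} → Γ ⊢ con k · e ∶ r →
  ∃[ l ] ∃[ α ] ∃[ t ] ∃[ s ] ∃[ q ] q ∈types k × q ≈ arrow α t s × Γ ⊢ e ∶ ●^ l t × ●^ l s ≈ r
constant-application⁻ {Γ = Γ} {e = e} d = case (constant⁻ function)
  where
  open Application (application⁻ d)
  case : (∃[ j ] ∃[ q ] q ∈types _ × ●^ j q ≈ ●^ level (arrow kind t s) × UnEnv Γ₁) →
    ∃[ l ] ∃[ α ] ∃[ t ] ∃[ s ] ∃[ q ] q ∈types _ × q ≈ arrow α t s × Γ ⊢ e ∶ ●^ l t × ●^ l s ≈ _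
  case (j , q , k , eq , un)
    with ●^-injective j level (constant-undelayed k) (arrow-undelayed kind) eq
  ... | _ , q≈ = delays + level , kind , t , s , q , k , q≈ ,
    ≈-conv (≡⇒≈ (sym (●^-+ delays level t)))
      (delay delays (weakening (sum-≼ʳ Γ₁ Γ₂ Γ sum (unEnv⁻ Γ₁ un)) argument)) ,
    result

return⁻ : ∀ {Γ : Env n} {e} k {t} → Γ ⊢ con return · e ∶ ●^ k (IO t) → Γ ⊢ e ∶ ●^ k t
return⁻ k d with constant-application⁻ d
... | l , α , _ , _ , _ , returnᵏ _ , q≈ , dₑ , r≈
  with arrow-injective unrestricted α q≈
... | a≈ , io≈
  with ●^-injective l k (λ ()) (λ ()) (≈-trans (●^-cong l io≈) r≈)
... | refl , io≈′ = ≈-conv (●^-cong k (≈-trans (≈-sym a≈) (IO-injective io≈′))) dₑ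

bind⁻ : ∀ {Γ : Env n} {e} k α {a b} → Γ ⊢ con bind · e ∶ ●^ k (arrow α a b) →
  ∃[ t ] ∃[ s ] Γ ⊢ e ∶ ●^ k (IO t) × a ≈ t ⊸ IO s × b ≈ IO s
bind⁻ k α d with constant-application⁻ d
... | l , κ , _ , _ , _ , bindᵏ {t} {s} _ _ , q≈ , dₑ , r≈
  with arrow-injective unrestricted κ q≈
... | a≈ , f≈
  with ●^-injective l k (λ ()) (arrow-undelayed α) (≈-trans (●^-cong l f≈) r≈)
... | refl , f≈′ with arrow-injective linear α f≈′
... | dom≈ , cod≈ =
  t , s , ≈-conv (●^-cong k (≈-sym a≈)) dₑ , ≈-sym dom≈ , ≈-sym cod≈

-- The two types of pair differ in their second arrow only.
pair-type : ∀ {q} → q ∈types pair → ∃[ t ] ∃[ s ] ∃[ α ] q ≡ t ⇒ arrow α s (t ⊗ s)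
pair-type (pairˡ _ _ _) = _ , _ , linear , refl
pair-type (pairᵘ _ _ _) = _ , _ , unrestricted , refl

pair₁⁻ : ∀ {Γ : Env n} {e} k α {a b} → Γ ⊢ con pair · e ∶ ●^ k (arrow α a b) →
  ∃[ t ] Γ ⊢ e ∶ ●^ k t × b ≈ t ⊗ a
pair₁⁻ k α d with constant-application⁻ d
... | l , κ , _ , _ , _ , q∈ , q≈ , dₑ , r≈ with pair-type q∈
... | t , s , γ , refl
  with arrow-injective unrestricted κ q≈
... | a≈ , f≈
  with ●^-injective l k (arrow-undelayed γ) (arrow-undelayed α) (≈-trans (●^-cong l f≈) r≈)
... | refl , f≈′ with arrow-injective γ α f≈′
... | dom≈ , cod≈ =
  t , ≈-conv (●^-cong k (≈-sym a≈)) dₑ , ≈-trans (≈-sym cod≈) (⊗-cong ≈-refl dom≈)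

-- The delays applied to the pair are passed on to its components.
pair⁻ : ∀ {Γ : Env n} {e₁ e₂} k {t₁ t₂} → Γ ⊢ con pair · e₁ · e₂ ∶ ●^ k (t₁ ⊗ t₂) →
  ∃[ Γ₁ ] ∃[ Γ₂ ] Γ₁ ⊢ e₁ ∶ ●^ k t₁ × Γ₂ ⊢ e₂ ∶ ●^ k t₂ × Sum Γ₁ Γ₂ Γ
pair⁻ {e₁ = e₁} k d with application⁻ d
... | A with pair₁⁻ (Application.level A) (Application.kind A) (Application.function A)
... | t′ , d₁ , s≈ with ●^-injective (delays + level) k (λ ()) (λ ())
    (≈-trans (●^-cong (delays + level) (≈-sym s≈)) result)
  where open Application A
... | level≡ , ⊗≈ with ⊗-injective ⊗≈
... | t₁≈ , t₂≈ =
  Γ₁ , Γ₂ , raise t₁≈ d₁ , raise t₂≈ argument , sum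
  where
  open Application A
  raise : ∀ {Γ e t t″} → t ≈ t″ → Γ ⊢ e ∶ ●^ level t → Γ ⊢ e ∶ ●^ k t″
  raise {t = t} eq d′ = ≈-conv (≈-trans (≡⇒≈ delayed) (●^-cong k eq)) (delay delays d′)
    where
    delayed : ●^ delays (●^ level t) ≡ ●^ k t
    delayed = trans (sym (●^-+ delays level t)) (cong (λ l → ●^ l t) level≡)

-- Preservation of typing by the reductions

infix 4 _⊑ₜ_
_⊑ₜ_ : Expr n → Expr n → Set
e ⊑ₜ e′ = ∀ {Γ t} → Γ ⊢ e ∶ t → Γ ⊢ e′ ∶ t

-- The delays between the introduction of the arrow and its elimination are those by
-- which f comes later than the body expects its variable.
preserve-β : ∀ {e : Expr (suc n)} {f} → lam e · f ⊑ₜ e [ f ]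
preserve-β {e = e} {f} {Γ} d with application⁻ d
... | A with abstraction⁻ (Application.function A)
... | B with ●^-injective (Abstraction.delays B + Abstraction.level B) (Application.level A)
    (arrow-undelayed (Abstraction.kind B)) (arrow-undelayed (Application.kind A)) (Abstraction.result B)
... | level≡ , arrow≈ with arrow-injective (Abstraction.kind B) (Application.kind A) arrow≈
... | t≈ , s≈ = ≈-conv (≈-trans result′ A.result) (delay A.delays (substitute expressions B.body
    (extend (identity B.delays A.Γ₁) (≈-conv argument≈ A.argument) A.sum)))
  where
  module A = Application A
  module B = Abstraction B
  at-level : ∀ t → ●^ B.delays (●^ B.level t) ≡ ●^ A.level t
  at-level t = trans (sym (●^-+ B.delays B.level t)) (cong (λ k → ●^ k t) level≡)
  argument≈ : ●^ A.level A.t ≈ ●^ B.delays (●^ B.level B.t)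
  argument≈ = ≈-trans (●^-cong A.level (≈-sym t≈)) (≡⇒≈ (sym (at-level B.t)))
  result′ : ●^ A.delays (●^ B.delays (●^ B.level B.s)) ≈ ●^ (A.delays + A.level) A.s
  result′ = ≈-trans
    (●^-cong A.delays (≈-trans (≡⇒≈ (at-level B.s)) (●^-cong A.level s≈)))
    (≡⇒≈ (sym (●^-+ A.delays A.level A.s)))

-- The function and its argument change places, hence so do their environments; f is
-- linear in its argument, so the application is typed by a linear arrow.
preserve-bind : ∀ {e f : Expr n} → con bind · (con return · e) · f ⊑ₜ f · e
preserve-bind d with application⁻ d
... | A with bind⁻ (Application.level A) (Application.kind A) (Application.function A)
... | t′ , s′ , dᵣ , dom≈ , cod≈ =
  ≈-conv (≈-trans (≡⇒≈ (sym (●^-+ delays level s))) result)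
    (delay delays (app level linear (●^-cong level dom≈) ≈-refl (●^-cong level (≈-sym cod≈))
      argument (return⁻ level dᵣ) (λ u → ⊞-comm (sum u))))
  where open Application A

-- The body belongs to the second summand and the pair to the first, so the sum has to
-- be reordered before the components can be added to the environment of the body one
-- by one.
preserve-split : ∀ {e₁ e₂ : Expr n} {f} → split (con pair · e₁ · e₂) f ⊑ₜ f [ e₁ , e₂ ]₂
preserve-split {Γ = Γ} d with splitting⁻ d
... | S with pair⁻ (Splitting.level S) (Splitting.pairing S)
... | Δ₁ , Δ₂ , d₁ , d₂ , sum′
  with sum-rotate Δ₁ Δ₂ (Splitting.Γ₂ S) (Splitting.Γ₁ S) Γ sum′ (Splitting.sum S)
... | Γ₃₁ , inner , outer =
  ≈-conv result (delay delays (substitute expressions body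
    (extend {Δ₁ = Γ₃₁} {Δ₂} {Γ} (extend {Δ₁ = Γ₂} {Δ₁} {Γ₃₁} (identity 0 Γ₂) d₁ inner) d₂ outer)))
  where open Splitting S

preserve-· : ∀ {e e′ f f′ : Expr n} → e ⊑ₜ e′ → f ⊑ₜ f′ → e · f ⊑ₜ e′ · f′
preserve-· p q d = application⁺ A (p (Application.function A)) (q (Application.argument A))
  where A = application⁻ d

preserve-split₁ : ∀ {e e′ : Expr n} {f} → e ⊑ₜ e′ → split e f ⊑ₜ split e′ f
preserve-split₁ p d =
  ≈-conv result (delay delays (elim-⊗ level refl refl refl refl (p pairing) ok₁ ok₂ body sum))
  where open Splitting (splitting⁻ d)

preserve-plug : ∀ (E : ECtx n) {e e′} → e ⊑ₜ e′ → plug E e ⊑ₜ plug E e′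
preserve-plug hole         p = p
preserve-plug (appᶜ E f)   p = preserve-· (preserve-plug E p) (λ d → d)
preserve-plug (splitᶜ E f) p = preserve-split₁ (preserve-plug E p)
preserve-plug (openᶜ E)    p = preserve-· (λ d → d) (preserve-plug E p)
preserve-plug (sendᶜ E)    p = preserve-· (λ d → d) (preserve-plug E p)
preserve-plug (recvᶜ E)    p = preserve-· (λ d → d) (preserve-plug E p)
preserve-plug (bindᶜ E)    p = preserve-· (λ d → d) (preserve-plug E p)

preserve : ∀ {e e′ : Expr n} → e ⟶ e′ → e ⊑ₜ e′
preserve β         = preserve-β
preserve β-bind    = preserve-bind
preserve β-split   = preserve-split
preserve (ctx E r) = preserve-plug E (preserve r)

theorem4p6 : ∀ {n : ℕ} (Γ : Env n) (e e′ : Expr n) (t : Tree) → IsType t →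
    Γ ⊢ e ∶ t → e ⟶ e′ → Γ ⊢ e′ ∶ t
theorem4p6 Γ e e′ t _ d r = preserve r d
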